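{- Let $n\ge 1$ and $L$ be integers with $2^{n-1}<L\le 2^n$, and let $m,h,t,s$, $\mathbf{S}$ and $\mathbf{R}$ be as described in the context, where, in case $n=2m-1$, the set $\mathbf{T}$ is assumed to contain the strings of the PCR cycle of $(01)^{m-1}1$. Define a map on length-$n$ binary strings as follows: for $\alpha=a_1\cdots a_n$, let $x=\mathrm{PCR3}(\alpha)$ and $\beta=a_2\cdots a_n x$; if $\beta\notin\mathbf{S}$ replace $x$ by $1-x$; then, if $\beta\in\mathbf{R}$, replace $x$ by $1-x$ (once more); the image of $\alpha$ is $a_2\cdots a_n x$. Starting from $\alpha^{(0)}=0^{n-1}1$ and iterating this map, the resulting sequence of first symbols is a binary cut-down de Bruijn sequence of length $L$; that is, $\alpha^{(L)}=\alpha^{(0)}$ and the cyclic string formed by the first symbols of $\alpha^{(0)},\dots,\alpha^{(L-1)}$ has length $L$ and contains every binary string of length $n$ at most once as a cyclic substring.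
   Context: Binary strings of length $n$; the weight of a binary string is its number of 1s. The period of $\alpha=a_1\cdots a_n$ is the least $p$ with $\alpha=(a_1\cdots a_p)^{n/p}$. A necklace is a string that is lexicographically smallest among its rotations. The pure cycling register (PCR) partitions $\{0,1\}^n$ into rotation classes ("PCR cycles"). $\mathrm{PCR3}(a_1\cdots a_n)=1-a_1$ if $a_2a_3\cdots a_n1$ is a necklace, and $=a_1$ otherwise. Let $A(w)$ be the number of binary length-$n$ strings with weight $\le w$, and $C(w,p)$ the number with weight $w$ and period $\le p$. Let $m$ be the least weight with $A(m)\ge L$; $h$ the least period with $A(m-1)+C(m,h)\ge L$; $t$ the least integer with $A(m-1)+C(m,h-1)+th\ge L$; $s=A(m-1)+C(m,h-1)+ht-L$. Let $\mathbf{T}$ be the set of strings lying on some chosen $t$ PCR cycles of weight $m$ and period $h$, and $\mathbf{S}$ the set of all length-$n$ binary strings of weight $<m$, all of weight $m$ and period $<h$, together with $\mathbf{T}$. For $i\ge1$ define $\gamma_1=0^n$; for $i>1$ with $i\mid n$, $\gamma_i=(0^{i-1}1)^{n/i}$; for $i>1$ with $i\nmid n$, $\gamma_i=0^y1(0^{i-1}1)^{x}$ where $x=\lfloor n/i\rfloor$ and $y=(n \bmod i)-1$. Let $j=\lceil n/2\rceil$; set $\mathbf{R}=\{\gamma_s\}$ if $1\le s\le j$, $\mathbf{R}=\{\gamma_j,\gamma_{s-j}\}$ if $s>j$, and $\mathbf{R}=\emptyset$ if $s=0$. A binary cut-down de Bruijn sequence of length $L$ (order $n$) is a cyclic binary string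 of length $L$ in which every length-$n$ string appears at most once as a substring. -}

module Defs where

open import Data.Bool using (Bool; true; false; not; _∧_; _∨_; if_then_else_)
open import Data.Nat using (ℕ; zero; suc; _+_; _*_; _∸_; _<ᵇ_; _≤ᵇ_; _≡ᵇ_; ⌈_/2⌉)
open import Data.Nat.DivMod using (_/_; _%_)
open import Data.List using (List; []; _∷_; [_]; _++_; length; map; concat; replicate; take; drop; upTo)
open import Data.Bool.ListAction using (any; all)
open import Data.List.Properties using (≡-dec)
import Data.Bool.Properties as BoolP
open import Relation.Nullary.Decidable using (⌊_⌋)

-- Binary strings are lists of booleans (false = 0, true = 1).
Str : Set
Str = List Bool

_==_ : Str → Str → Bool
a == b = ⌊ ≡-dec BoolP._≟_ a b ⌋

allStrings : ℕ → List Str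
allStrings zero    = [ [] ]
allStrings (suc n) = map (false ∷_) (allStrings n) ++ map (true ∷_) (allStrings n)

countB : {A : Set} → (A → Bool) → List A → ℕ
countB p []       = 0
countB p (x ∷ xs) = if p x then suc (countB p xs) else countB p xs

weight : Str → ℕ
weight []           = 0
weight (true ∷ xs)  = suc (weight xs)
weight (false ∷ xs) = weight xs

repeatsWith : ℕ → Str → Bool
repeatsWith zero    a = false
repeatsWith (suc q) a =
  ((length a % suc q) ≡ᵇ 0) ∧ (a == concat (replicate (length a / suc q) (take (suc q) a)))

period : Str → ℕ
period a = go 1 (length a)
  where
  go : ℕ → ℕ → ℕ
  go p zero    = p
  go p (suc k) = if repeatsWith p a then p else go (suc p) k

rotate : ℕ → Str → Str
rotate i a = drop i a ++ take i a

_≤lex_ : Str → Str → Bool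
[]           ≤lex _            = true
(_ ∷ _)      ≤lex []           = false
(false ∷ xs) ≤lex (true ∷ ys)  = true
(true ∷ xs)  ≤lex (false ∷ ys) = false
(false ∷ xs) ≤lex (false ∷ ys) = xs ≤lex ys
(true ∷ xs)  ≤lex (true ∷ ys)  = xs ≤lex ys

necklace : Str → Bool
necklace a = all (λ i → a ≤lex rotate i a) (upTo (length a))

PCR3 : Str → Bool
PCR3 []       = false
PCR3 (a ∷ as) = if necklace (as ++ [ true ]) then not a else a

A : ℕ → ℕ → ℕ
A n w = countB (λ a → weight a ≤ᵇ w) (allStrings n)

C : ℕ → ℕ → ℕ → ℕ
C n w p = countB (λ a → (weight a ≡ᵇ w) ∧ (period a ≤ᵇ p)) (allStrings n)

-- β lies on the PCR cycle of some representative in reps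
-- (T = union of the PCR cycles of the representatives)
inT : List Str → Str → Bool
inT reps b = any (λ r → any (λ i → rotate i b == r) (upTo (length b))) reps

inS : ℕ → ℕ → List Str → Str → Bool
inS m h reps b = (weight b <ᵇ m) ∨ (((weight b ≡ᵇ m) ∧ (period b <ᵇ h)) ∨ inT reps b)

blk : ℕ → Str
blk i = replicate (i ∸ 1) false ++ [ true ]

gamma : ℕ → ℕ → Str
gamma n zero          = []   -- never used (i ≥ 1)
gamma n (suc zero)    = replicate n false
gamma n (suc (suc k)) =
  if (n % suc (suc k)) ≡ᵇ 0
  then concat (replicate (n / suc (suc k)) (blk (suc (suc k))))
  else replicate ((n % suc (suc k)) ∸ 1) false ++ (true ∷ concat (replicate (n / suc (suc k)) (blk (suc (suc k)))))

inR : ℕ → ℕ → Str → Bool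
inR n s b =
  if s ≡ᵇ 0 then false
  else if s ≤ᵇ ⌈ n /2⌉ then b == gamma n s
  else ((b == gamma n ⌈ n /2⌉) ∨ (b == gamma n (s ∸ ⌈ n /2⌉)))

step : (n m h s : ℕ) → List Str → Str → Str
step n m h s reps []       = []
step n m h s reps (a ∷ as) = as ++ [ x2 ]
  where
  x0 : Bool
  x0 = PCR3 (a ∷ as)
  β : Str
  β = as ++ [ x0 ]
  x1 : Bool
  x1 = if inS m h reps β then x0 else not x0
  x2 : Bool
  x2 = if inR n s β then not x1 else x1

iter : {X : Set} → (X → X) → ℕ → X → X
iter f zero    x = x
iter f (suc k) x = f (iter f k x)

firstSym : Str → Bool
firstSym []      = false
firstSym (b ∷ _) = b

altStr : ℕ → Str
altStr m = concat (replicate (m ∸ 1) (false ∷ true ∷ [])) ++ [ true ]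

-- length-n cyclic substring of the cyclic string c starting at position i (0 ≤ i < length c)
cycWindow : Str → ℕ → ℕ → Str
cycWindow c n i = take n (drop i (concat (replicate (suc (suc n)) c)))

{-# OPTIONS --safe #-}

-- The PCR cycles form a tree rooted at 0ⁿ: the necklace b1 hangs below the
-- cycle of b0, and PCR3 splices the two cycles at the states 0b and 1b. S is
-- closed under rotation and under passing to the parent, so the map without R
-- traverses all of S in a single cycle: an excursion entering the cycle of b1
-- at b1 leaves it at 1b, having visited the whole subtree.
--
-- For 1 < i ≤ ⌈n/2⌉ the states following γᵢ on this cycle are obtained by
-- appending zeros, namely the suffixes of length n of ⋯(0ⁱ⁻¹1)(0ⁱ⁻¹1)0ᵏ for
-- k < i, and the state after them is γᵢ with its last symbol flipped. Flipping
-- the successor γᵢ thus skips exactly i states; for i = 1 it skips 0ⁿ only.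
-- The skipped segments are disjoint and their lengths add up to s = |S| − L.
-- That γᵢ ∈ S follows from n ≤ 2m, which L > 2ⁿ⁻¹ forces; only γ₂ can have
-- weight m, and then it has period 2 < h or is a rotation of (01)ᵐ⁻¹1.

module Submission where

open import Defs
open import Data.Bool using (Bool; true; false; not; _∧_; _∨_; if_then_else_; T)
open import Data.Bool.ListAction using (any; all)
import Data.Bool.Properties as BoolP
open import Data.Empty using (⊥-elim)
open import Data.List using (List; []; _∷_; [_]; _++_; length; map; concat; replicate; take; drop; upTo; applyUpTo; filter; concatMap)
open import Data.List.Membership.Propositional using (_∈_; _∉_; find; lose)
open import Data.List.Membership.Propositional.Properties
open import Data.List.Properties
open import Data.List.Relation.Unary.All as All using (All; []; _∷_)
open import Data.List.Relation.Unary.AllPairs using ([]; _∷_)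
open import Data.List.Relation.Unary.Any using (here; there; any?)
open import Data.List.Relation.Unary.Unique.Propositional using (Unique)
import Data.List.Relation.Unary.Unique.Propositional.Properties as Uniq
open import Data.Nat
open import Data.Nat.Divisibility using (_∣_; divides; ∣-refl; ∣⇒≤; m%n≡0⇒n∣m)
open import Data.Nat.DivMod using (m%n<n; m≡m%n+[m/n]*n; m*n%n≡0; m*n/n≡m)
open import Data.Nat.ListAction using (sum)
open import Data.Nat.Properties
open import Data.Nat.Solver using (module +-*-Solver)
open import Data.Product as Product using (∃; ∃₂; _×_; _,_; proj₁; proj₂; map₂)
open import Data.Sum using (_⊎_; inj₁; inj₂; [_,_]′)
open import Function using (_∘_; id)
open import Relation.Binary.Definitions using (tri<; tri≈; tri>)
open import Relation.Binary.PropositionalEquality hiding ([_])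
open import Relation.Nullary using (¬_; Dec; yes; no; ¬?)


-- The length of the final cycle is not found by following it. `Orbit` asks for a duplicate-free
-- list that contains every iterate of `α₀` and whose members are all reached from `α₀`; the cycle
-- length is the length of that list, which is counted. The list is S without the skipped strings,
-- on which the map with R is the first-return map of the map without R.
--
-- Put p = i - 1. The bound i ≤ ⌈n/2⌉ reads 2p + 1 ≤ n and acts twice. It puts a full run 0ᵖ behind
-- the first 1 of every segment state starting with 0, so that a comparison of runs decides the
-- necklace test of PCR3; and it lets p and k be read off from a state, which makes the segments
-- disjoint. The positive necklace tests rest on minimality among all strings of the same length and
-- weight without runs of more than p zeros, since the rotations of a string ending in 1 stay in
-- that class.
--
-- Two points about R need care: it is tested before the correction by S, and it flips only once, so
-- neither a corrected step nor the target of a flip may be some γᵢ. That two indices are enough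
-- comes from s < h ≤ n.

private variable
  X : Set

-- Iteration and orbits

iter-suc : ∀ (f : X → X) k x → iter f (suc k) x ≡ iter f k (f x)
iter-suc f zero    x = refl
iter-suc f (suc k) x = cong f (iter-suc f k x)

iter-+ : ∀ (f : X → X) j k x → iter f (j + k) x ≡ iter f j (iter f k x)
iter-+ f zero    k x = refl
iter-+ f (suc j) k x = cong f (iter-+ f j k x)

Reach : (X → X) → X → X → Set
Reach f x y = ∃ λ k → iter f k x ≡ y

reach-trans : ∀ {f : X → X} {x y z} → Reach f x y → Reach f y z → Reach f x z
reach-trans {f = f} {x} (j , refl) (k , refl) = k + j , iter-+ f k j x

reach-step : ∀ {f : X → X} {x y} → f x ≡ y → Reach f x y
reach-step e = 1 , e

least : ∀ {P : ℕ → Set} → (∀ k → Dec (P k)) → ∀ k → P k →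
        ∃ λ l → P l × (∀ j → j < l → ¬ P j)
least {P} P? k pk = [ id , (λ none → k , pk , none) ]′ (below k)
  where
  below : ∀ k → (∃ λ l → P l × (∀ j → j < l → ¬ P j)) ⊎ (∀ j → j < k → ¬ P j)
  below zero    = inj₂ λ _ ()
  below (suc k) with below k
  ... | inj₁ found = inj₁ found
  ... | inj₂ none with P? k
  ...   | yes pk = inj₁ (k , pk , none)
  ...   | no ¬pk = inj₂ λ j j<1+k pj →
            [ (λ j<k → none j j<k pj) , (λ { refl → ¬pk pj }) ]′ (m≤n⇒m<n∨m≡n (≤-pred j<1+k))

unique-⊆-length : ∀ {xs ys : List X} → Unique xs → (∀ {x} → x ∈ xs → x ∈ ys) →
                  length xs ≤ length ys
unique-⊆-length {xs = []}     _          _   = z≤n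
unique-⊆-length {xs = x ∷ xs} (x∉ ∷ uxs) sub with ∈-∃++ (sub (here refl))
... | as , bs , refl = begin
    suc (length xs)             ≤⟨ s≤s (unique-⊆-length uxs sub′) ⟩
    suc (length (as ++ bs))     ≡⟨ cong suc (length-++ as) ⟩
    suc (length as + length bs) ≡⟨ sym (+-suc (length as) (length bs)) ⟩
    length as + suc (length bs) ≡⟨ sym (length-++ as) ⟩
    length (as ++ x ∷ bs)       ∎
  where
  open ≤-Reasoning
  sub′ : ∀ {y} → y ∈ xs → y ∈ as ++ bs
  sub′ y∈ with ∈-++⁻ as (sub (there y∈))
  ... | inj₁ y∈as         = ∈-++⁺ˡ y∈as
  ... | inj₂ (here refl)  = ⊥-elim (All.lookup x∉ y∈ refl)
  ... | inj₂ (there y∈bs) = ∈-++⁺ʳ as y∈bs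

unique-⇔-length : ∀ {xs ys : List X} → Unique xs → Unique ys →
                  (∀ {x} → x ∈ xs → x ∈ ys) → (∀ {x} → x ∈ ys → x ∈ xs) →
                  length xs ≡ length ys
unique-⇔-length ux uy s₁ s₂ = ≤-antisym (unique-⊆-length ux s₁) (unique-⊆-length uy s₂)

module Orbit {X : Set} (_≟_ : (x y : X) → Dec (x ≡ y)) (f : X → X) (z : X)
             (ret : ∃ λ k → iter f (suc k) z ≡ z)
             {U : List X} (uniqueU : Unique U)
             (covers : ∀ {y} → y ∈ U → Reach f z y) (stays : ∀ k → iter f k z ∈ U) where

  private
    first : ∃ λ l → iter f (suc l) z ≡ z × (∀ j → j < l → ¬ iter f (suc j) z ≡ z)
    first = least (λ k → iter f (suc k) z ≟ z) (proj₁ ret) (proj₂ ret)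

    K : ℕ
    K = suc (proj₁ first)

    orb : List X
    orb = applyUpTo (λ k → iter f k z) K

    period-K : iter f K z ≡ z
    period-K = proj₁ (proj₂ first)

    -- Following a coincidence at `i < j` for the `K - j` steps left until the return gives a return
    -- after only `i + (K - j) < K` steps, against the choice of `K`. Here `suc d` is `K - j`.
    distinct : ∀ {i j} → i < j → j < K → iter f i z ≢ iter f j z
    distinct {i} {j} i<j j<K e = proj₂ (proj₂ first) (i + d) early (begin
        iter f (suc (i + d)) z    ≡⟨ cong (λ q → iter f (suc q) z) (+-comm i d) ⟩
        iter f (suc d + i) z      ≡⟨ iter-+ f (suc d) i z ⟩
        iter f (suc d) (iter f i z) ≡⟨ cong (iter f (suc d)) e ⟩
        iter f (suc d) (iter f j z) ≡⟨ sym (iter-+ f (suc d) j z) ⟩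
        iter f (suc d + j) z      ≡⟨ cong (λ q → iter f (suc q) z) (m∸n+n≡m (≤-pred j<K)) ⟩
        iter f K z                ≡⟨ period-K ⟩
        z ∎)
      where
      open ≡-Reasoning
      d = proj₁ first ∸ j
      early : i + d < proj₁ first
      early = subst (i + d <_) (m+[n∸m]≡n (≤-pred j<K)) (+-monoˡ-< d i<j)

    wrap : ∀ k → ∃ λ l → l < K × iter f l z ≡ iter f k z
    wrap zero    = 0 , s≤s z≤n , refl
    wrap (suc k) with wrap k
    ... | l , l<K , e with m≤n⇒m<n∨m≡n l<K
    ...   | inj₁ 1+l<K = suc l , 1+l<K , cong f e
    ...   | inj₂ 1+l≡K = 0 , s≤s z≤n ,
              trans (sym period-K) (trans (cong (λ q → iter f q z) (sym 1+l≡K)) (cong f e))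

    length-U : length U ≡ K
    length-U = trans (unique-⇔-length uniqueU (Uniq.applyUpTo⁺₁ _ K distinct) U⊆ ⊆U)
                     (length-applyUpTo (λ k → iter f k z) K)
      where
      U⊆ : ∀ {y} → y ∈ U → y ∈ orb
      U⊆ y∈ with covers y∈
      ... | k , refl with wrap k
      ...   | l , l<K , e = subst (_∈ orb) e (∈-applyUpTo⁺ (λ k → iter f k z) l<K)
      ⊆U : ∀ {y} → y ∈ orb → y ∈ U
      ⊆U y∈ with ∈-applyUpTo⁻ (λ k → iter f k z) y∈
      ... | i , _ , refl = stays i

  returns : iter f (length U) z ≡ z
  returns = trans (cong (λ q → iter f q z) length-U) period-K

  injective : ∀ i j → i < length U → j < length U → iter f i z ≡ iter f j z → i ≡ j
  injective i j i< j< e with <-cmp i j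
  ... | tri< i<j _ _ = ⊥-elim (distinct i<j (subst (j <_) length-U j<) e)
  ... | tri≈ _ i≡j _ = i≡j
  ... | tri> _ _ j<i = ⊥-elim (distinct j<i (subst (i <_) length-U i<) (sym e))

-- Reflection of Boolean tests

∧-true⁻ : ∀ {a b} → a ∧ b ≡ true → a ≡ true × b ≡ true
∧-true⁻ {true} {true} _ = refl , refl

∨-true⁻ : ∀ {a b} → a ∨ b ≡ true → a ≡ true ⊎ b ≡ true
∨-true⁻ {true}  _ = inj₁ refl
∨-true⁻ {false} e = inj₂ e

∨-trueˡ : ∀ {a b} → a ≡ true → a ∨ b ≡ true
∨-trueˡ refl = refl

∨-trueʳ : ∀ {a b} → b ≡ true → a ∨ b ≡ true
∨-trueʳ {a} refl = BoolP.∨-zeroʳ a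

true≢false : true ≢ false
true≢false ()

true-or-false : ∀ b → b ≡ true ⊎ b ≡ false
true-or-false true  = inj₁ refl
true-or-false false = inj₂ refl

not-true⇒false : ∀ {b} → b ≢ true → b ≡ false
not-true⇒false {true}  ne = ⊥-elim (ne refl)
not-true⇒false {false} _  = refl

_≟ₛ_ : (a b : Str) → Dec (a ≡ b)
_≟ₛ_ = ≡-dec BoolP._≟_

==⇒≡ : ∀ {a b} → (a == b) ≡ true → a ≡ b
==⇒≡ {a} {b} e with a ≟ₛ b
... | yes p = p

≡⇒== : ∀ {a b} → a ≡ b → (a == b) ≡ true
≡⇒== {a} {b} e with a ≟ₛ b
... | yes _ = refl
... | no ¬p = ⊥-elim (¬p e)

≤ᵇ-true : ∀ {a b} → a ≤ b → (a ≤ᵇ b) ≡ true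
≤ᵇ-true {a} {b} le with a ≤ᵇ b | ≤⇒≤ᵇ le
... | true | _ = refl

≤ᵇ-true⁻ : ∀ {a b} → (a ≤ᵇ b) ≡ true → a ≤ b
≤ᵇ-true⁻ {a} {b} e = ≤ᵇ⇒≤ a b (subst T (sym e) _)

<ᵇ-true : ∀ {a b} → a < b → (a <ᵇ b) ≡ true
<ᵇ-true {a} {b} lt with a <ᵇ b | <⇒<ᵇ lt
... | true | _ = refl

<ᵇ-true⁻ : ∀ {a b} → (a <ᵇ b) ≡ true → a < b
<ᵇ-true⁻ {a} {b} e = <ᵇ⇒< a b (subst T (sym e) _)

≡ᵇ-true : ∀ {a b} → a ≡ b → (a ≡ᵇ b) ≡ true
≡ᵇ-true {a} {b} eq with a ≡ᵇ b | ≡⇒≡ᵇ a b eq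
... | true | _ = refl

≡ᵇ-true⁻ : ∀ {a b} → (a ≡ᵇ b) ≡ true → a ≡ b
≡ᵇ-true⁻ {a} {b} e = ≡ᵇ⇒≡ a b (subst T (sym e) _)

all-applyUpTo⁺ : ∀ {X : Set} (p : X → Bool) f k → (∀ i → i < k → p (f i) ≡ true) →
                 all p (applyUpTo f k) ≡ true
all-applyUpTo⁺ p f zero    _ = refl
all-applyUpTo⁺ p f (suc k) h =
  cong₂ _∧_ (h 0 z<s) (all-applyUpTo⁺ p (f ∘ suc) k (λ i i<k → h (suc i) (s<s i<k)))

all-applyUpTo⁻ : ∀ {X : Set} (p : X → Bool) f k → all p (applyUpTo f k) ≡ true →
                 ∀ i → i < k → p (f i) ≡ true
all-applyUpTo⁻ p f (suc k) e zero    _     = proj₁ (∧-true⁻ e)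
all-applyUpTo⁻ p f (suc k) e (suc i) i<k   =
  all-applyUpTo⁻ p (f ∘ suc) k (proj₂ (∧-true⁻ {p (f 0)} e)) i (≤-pred i<k)

any-true⁺ : ∀ {X : Set} (p : X → Bool) {x xs} → x ∈ xs → p x ≡ true → any p xs ≡ true
any-true⁺ p (here refl)         e = ∨-trueˡ e
any-true⁺ p {xs = y ∷ _} (there x∈) e = ∨-trueʳ {p y} (any-true⁺ p x∈ e)

any-true⁻ : ∀ {X : Set} (p : X → Bool) xs → any p xs ≡ true → ∃ λ x → x ∈ xs × p x ≡ true
any-true⁻ p (x ∷ xs) e with ∨-true⁻ {p x} e
... | inj₁ px = x , here refl , px
... | inj₂ e′ with any-true⁻ p xs e′
...   | y , y∈ , py = y , there y∈ , py

-- Rotations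

rot : Str → Str
rot []      = []
rot (a ∷ u) = u ++ [ a ]

length-∷ʳ : ∀ (u : Str) a → length (u ++ [ a ]) ≡ suc (length u)
length-∷ʳ u a = trans (length-++ u) (+-comm (length u) 1)

length-rot : ∀ a → length (rot a) ≡ length a
length-rot []      = refl
length-rot (a ∷ u) = length-∷ʳ u a

length-rots : ∀ k a → length (iter rot k a) ≡ length a
length-rots zero    a = refl
length-rots (suc k) a = trans (length-rot (iter rot k a)) (length-rots k a)

weight-++ : ∀ u v → weight (u ++ v) ≡ weight u + weight v
weight-++ []          v = refl
weight-++ (true ∷ u)  v = cong suc (weight-++ u v)
weight-++ (false ∷ u) v = weight-++ u v

weight-∷ʳ-true : ∀ u → weight (u ++ [ true ]) ≡ suc (weight u)
weight-∷ʳ-true u = trans (weight-++ u _) (+-comm (weight u) 1)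

weight-∷ʳ-false : ∀ u → weight (u ++ [ false ]) ≡ weight u
weight-∷ʳ-false u = trans (weight-++ u _) (+-identityʳ (weight u))

weight-rot : ∀ a → weight (rot a) ≡ weight a
weight-rot []          = refl
weight-rot (true ∷ u)  = weight-∷ʳ-true u
weight-rot (false ∷ u) = weight-∷ʳ-false u

weight-rots : ∀ k a → weight (iter rot k a) ≡ weight a
weight-rots zero    a = refl
weight-rots (suc k) a = trans (weight-rot (iter rot k a)) (weight-rots k a)

rots-++ : ∀ u v → iter rot (length u) (u ++ v) ≡ v ++ u
rots-++ []      v = sym (++-identityʳ v)
rots-++ (a ∷ u) v = begin
  iter rot (suc (length u)) (a ∷ u ++ v)  ≡⟨ iter-suc rot (length u) _ ⟩
  iter rot (length u) ((u ++ v) ++ [ a ]) ≡⟨ cong (iter rot (length u)) (++-assoc u v [ a ]) ⟩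
  iter rot (length u) (u ++ (v ++ [ a ])) ≡⟨ rots-++ u (v ++ [ a ]) ⟩
  (v ++ [ a ]) ++ u                       ≡⟨ ++-assoc v [ a ] u ⟩
  v ++ a ∷ u                              ∎
  where open ≡-Reasoning

rots-length : ∀ a → iter rot (length a) a ≡ a
rots-length a = trans (cong (iter rot (length a)) (sym (++-identityʳ a))) (rots-++ a [])

length-take-≤ : ∀ i (a : Str) → i ≤ length a → length (take i a) ≡ i
length-take-≤ i a i≤ = trans (length-take i a) (m≤n⇒m⊓n≡m i≤)

rotate-rots : ∀ i a → i ≤ length a → rotate i a ≡ iter rot i a
rotate-rots i a i≤ = begin
  drop i a ++ take i a                                      ≡⟨ sym (rots-++ (take i a) (drop i a)) ⟩
  iter rot (length (take i a)) (take i a ++ drop i a)       ≡⟨ cong₂ (iter rot) (length-take-≤ i a i≤) (take++drop≡id i a) ⟩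
  iter rot i a                                              ∎
  where open ≡-Reasoning

rots-< : ∀ a → 0 < length a → ∀ k → ∃ λ l → l < length a × iter rot l a ≡ iter rot k a
rots-< a pos zero    = 0 , pos , refl
rots-< a pos (suc k) with rots-< a pos k
... | l , l< , e with m≤n⇒m<n∨m≡n l<
...   | inj₁ 1+l< = suc l , 1+l< , cong rot e
...   | inj₂ 1+l≡ = 0 , pos ,
          trans (sym (rots-length a)) (trans (cong (λ q → iter rot q a) (sym 1+l≡)) (cong rot e))

rots-comm : ∀ j k a → iter rot j (iter rot k a) ≡ iter rot k (iter rot j a)
rots-comm j k a = trans (sym (iter-+ rot j k a))
  (trans (cong (λ q → iter rot q a) (+-comm j k)) (iter-+ rot k j a))

-- Rotations are cyclic, so going back amounts to going further: one rotation is undone by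
-- `length a ∸ 1` more.
unrot : ∀ k a → ∃ λ l → iter rot l (iter rot k a) ≡ a
unrot zero    a = 0 , refl
unrot (suc k) a with unrot k a
... | l , e = l + (length a ∸ 1) , trans (iter-+ rot l (length a ∸ 1) _)
              (trans (cong (iter rot l) (undo (length a) (iter rot k a) (length-rots k a))) e)
  where
  undo : ∀ n b → length b ≡ n → iter rot (n ∸ 1) (rot b) ≡ b
  undo .0                  []      refl = refl
  undo .(suc (length u)) (x ∷ u) refl = rots-++ u [ x ]

-- Lexicographic order and necklaces

≤lex-refl : ∀ a → (a ≤lex a) ≡ true
≤lex-refl []          = refl
≤lex-refl (true ∷ a)  = ≤lex-refl a
≤lex-refl (false ∷ a) = ≤lex-refl a

≤lex-trans : ∀ a b c → (a ≤lex b) ≡ true → (b ≤lex c) ≡ true → (a ≤lex c) ≡ true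
≤lex-trans []          b           c           p q = refl
≤lex-trans (true ∷ a)  (true ∷ b)  (true ∷ c)  p q = ≤lex-trans a b c p q
≤lex-trans (false ∷ a) (true ∷ b)  (true ∷ c)  p q = refl
≤lex-trans (false ∷ a) (false ∷ b) (true ∷ c)  p q = refl
≤lex-trans (false ∷ a) (false ∷ b) (false ∷ c) p q = ≤lex-trans a b c p q

≤lex-antisym : ∀ a b → (a ≤lex b) ≡ true → (b ≤lex a) ≡ true → a ≡ b
≤lex-antisym []          []          p q = refl
≤lex-antisym (true ∷ a)  (true ∷ b)  p q = cong (true ∷_) (≤lex-antisym a b p q)
≤lex-antisym (false ∷ a) (false ∷ b) p q = cong (false ∷_) (≤lex-antisym a b p q)

≤lex-total : ∀ a b → (a ≤lex b) ≡ true ⊎ (b ≤lex a) ≡ true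
≤lex-total []          b           = inj₁ refl
≤lex-total (_ ∷ a)     []          = inj₂ refl
≤lex-total (true ∷ a)  (true ∷ b)  = ≤lex-total a b
≤lex-total (true ∷ a)  (false ∷ b) = inj₂ refl
≤lex-total (false ∷ a) (true ∷ b)  = inj₁ refl
≤lex-total (false ∷ a) (false ∷ b) = ≤lex-total a b

necklace⁺ : ∀ a → (∀ k → (a ≤lex iter rot k a) ≡ true) → necklace a ≡ true
necklace⁺ a h = all-applyUpTo⁺ (λ i → a ≤lex rotate i a) id (length a) λ i i< →
  trans (cong (a ≤lex_) (rotate-rots i a (<⇒≤ i<))) (h i)

necklace⁻ : ∀ a → necklace a ≡ true → ∀ k → (a ≤lex iter rot k a) ≡ true
necklace⁻ []      e k = refl
necklace⁻ (x ∷ u) e k with rots-< (x ∷ u) z<s k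
... | l , l< , eq = trans (cong ((x ∷ u) ≤lex_) (trans (sym eq) (sym (rotate-rots l (x ∷ u) (<⇒≤ l<)))))
                      (all-applyUpTo⁻ (λ i → (x ∷ u) ≤lex rotate i (x ∷ u)) id _ e l l<)

necklace-unique : ∀ a b → necklace a ≡ true → necklace b ≡ true → ∀ k → iter rot k a ≡ b → a ≡ b
necklace-unique a b na nb k refl with unrot k a
... | l , e = ≤lex-antisym a b (necklace⁻ a na k) (subst (λ c → (b ≤lex c) ≡ true) e (necklace⁻ b nb l))

necklace-exists : ∀ a → ∃ λ k → necklace (iter rot k a) ≡ true
necklace-exists []        = 0 , refl
necklace-exists a@(_ ∷ _) with minimum (length a)
  where
  minimum : ∀ M → ∃ λ k → ∀ j → j < M → (iter rot k a ≤lex iter rot j a) ≡ true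
  minimum zero    = 0 , λ _ ()
  minimum (suc M) with minimum M
  ... | k , min with ≤lex-total (iter rot k a) (iter rot M a)
  ...   | inj₁ le = k , λ j j< → [ min j , (λ { refl → le }) ]′ (m≤n⇒m<n∨m≡n (≤-pred j<))
  ...   | inj₂ ge = M , λ j j< → [ (λ j<M → ≤lex-trans (iter rot M a) (iter rot k a) _ ge (min j j<M))
                                 , (λ { refl → ≤lex-refl (iter rot M a) }) ]′ (m≤n⇒m<n∨m≡n (≤-pred j<))
... | k , min = k , necklace⁺ (iter rot k a) λ j → subst (λ c → (iter rot k a ≤lex c) ≡ true) (iter-+ rot j k a) (rest (j + k))
  where
  rest : ∀ j → (iter rot k a ≤lex iter rot j a) ≡ true
  rest j with rots-< a z<s j
  ... | l , l< , e = subst (λ c → (iter rot k a ≤lex c) ≡ true) e (min l l<)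

-- Comparing heads forces `b` to begin with 0, and cancelling that 0 leaves the same inequality for
-- the tail.
≤lex-shift-zero : ∀ b → ((b ++ [ false ]) ≤lex (false ∷ b)) ≡ true → weight b ≡ 0
≤lex-shift-zero []          e = refl
≤lex-shift-zero (false ∷ b) e = ≤lex-shift-zero b e

snoc-view : ∀ (a : Str) → 0 < length a → ∃₂ λ b x → a ≡ b ++ [ x ]
snoc-view (x ∷ [])    _ = [] , x , refl
snoc-view (x ∷ y ∷ a) _ with snoc-view (y ∷ a) z<s
... | b , z , e = x ∷ b , z , cong (x ∷_) e

rots-∷ʳ : ∀ b x → iter rot (length b) (b ++ [ x ]) ≡ x ∷ b
rots-∷ʳ b x = rots-++ b [ x ]

-- A final 0 could be rotated to the front, and minimality would then make the whole string zero.
-- This provides the form b1, and with it a parent, for every cycle other than that of 0ⁿ.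
necklace-ends-true : ∀ a → necklace a ≡ true → 0 < weight a → ∃ λ b → a ≡ b ++ [ true ]
necklace-ends-true a@(_ ∷ _) na pos with snoc-view a z<s
... | b , true  , e    = b , e
... | b , false , e = ⊥-elim (<-irrefl (sym w0) pos)
  where
  na′ : necklace (b ++ [ false ]) ≡ true
  na′ = subst (λ c → necklace c ≡ true) e na
  w0 : weight a ≡ 0
  w0 = trans (cong weight e) (trans (weight-∷ʳ-false b) (≤lex-shift-zero b
         (subst (λ c → ((b ++ [ false ]) ≤lex c) ≡ true) (rots-∷ʳ b false) (necklace⁻ (b ++ [ false ]) na′ (length b)))))

weight-replicate-false : ∀ n → weight (replicate n false) ≡ 0
weight-replicate-false zero    = refl
weight-replicate-false (suc n) = weight-replicate-false n

weight-zero : ∀ a → weight a ≡ 0 → a ≡ replicate (length a) false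
weight-zero []          _ = refl
weight-zero (false ∷ a) e = cong (false ∷_) (weight-zero a e)

-- Periods

pow : ℕ → Str → Str
pow q w = concat (replicate q w)

pow-comm : ∀ q w → pow q w ++ w ≡ w ++ pow q w
pow-comm zero    w = sym (++-identityʳ w)
pow-comm (suc q) w = trans (++-assoc w (pow q w) w) (cong (w ++_) (pow-comm q w))

length-pow : ∀ q w → length (pow q w) ≡ q * length w
length-pow zero    w = refl
length-pow (suc q) w = trans (length-++ w) (cong (length w +_) (length-pow q w))

rots-pow : ∀ q w → iter rot (length w) (pow (suc q) w) ≡ pow (suc q) w
rots-pow q w = trans (rots-++ w (pow q w)) (pow-comm q w)

take-++-≤ : ∀ i (u v : Str) → i ≤ length u → take i (u ++ v) ≡ take i u
take-++-≤ zero    u       v _  = refl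
take-++-≤ (suc i) (x ∷ u) v i≤ = cong (x ∷_) (take-++-≤ i u v (≤-pred i≤))

take-length-++ : ∀ (u v : Str) → take (length u) (u ++ v) ≡ u
take-length-++ []      v = refl
take-length-++ (x ∷ u) v = cong (x ∷_) (take-length-++ u v)

-- As long as `v` is at least as long as `u`, the equation makes `u` a prefix of `v`; cancelling it
-- leaves the same equation for the rest. The length condition makes the recursion end at the empty
-- string.
commute⇒pow : ∀ q u v → length v ≡ q * length u → u ++ v ≡ v ++ u → v ≡ pow q u
commute⇒pow zero    u []      _ _ = refl
commute⇒pow (suc q) u v       l e = trans v≡ (cong (u ++_) (commute⇒pow q u v′ l′ e′))
  where
  v′ = drop (length u) v
  u≤v : length u ≤ length v
  u≤v = subst (length u ≤_) (sym l) (m≤m+n (length u) (q * length u))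
  u≡ : take (length u) v ≡ u
  u≡ = trans (sym (take-++-≤ (length u) v u u≤v)) (trans (cong (take (length u)) (sym e)) (take-length-++ u v))
  v≡ : v ≡ u ++ v′
  v≡ = trans (sym (take++drop≡id (length u) v)) (cong (_++ v′) u≡)
  l′ : length v′ ≡ q * length u
  l′ = trans (length-drop (length u) v) (trans (cong (_∸ length u) l) (m+n∸m≡n (length u) _))
  e′ : u ++ v′ ≡ v′ ++ u
  e′ = ++-cancelˡ u _ _ (trans (cong (u ++_) (sym v≡))
         (trans e (trans (cong (_++ u) v≡) (++-assoc u v′ u))))

-- A form of `repeatsWith` that passes to rotations at once, since rotations commute.
record Repeats (p : ℕ) (a : Str) : Set where
  constructor repeats
  field
    positive       : 0 < p
    divides-length : p ∣ length a
    fixes          : iter rot p a ≡ a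

repeatsWith⁻ : ∀ p a → 0 < length a → repeatsWith p a ≡ true → Repeats p a
repeatsWith⁻ (suc q) a pos e = repeats z<s p∣n (fix (length a / p) refl)
  where
  p = suc q
  p∣n : p ∣ length a
  p∣n = m%n≡0⇒n∣m (length a) p (≡ᵇ-true⁻ (proj₁ (∧-true⁻ e)))
  p≤n : p ≤ length a
  p≤n = ∣⇒≤ {{>-nonZero pos}} p∣n
  w = take p a
  a≡ : a ≡ pow (length a / p) w
  a≡ = ==⇒≡ (proj₂ (∧-true⁻ {length a % p ≡ᵇ 0} e))
  |w| : length w ≡ p
  |w| = length-take-≤ p a p≤n
  -- The quotient is abstracted to `x` so that it can be split; zero would make `a` empty.
  fix : ∀ x → x ≡ length a / p → iter rot p a ≡ a
  fix zero    x≡ = ⊥-elim (<-irrefl (sym (trans (cong length a≡)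
                     (cong (λ y → length (pow y w)) (sym x≡)))) pos)
  fix (suc x) x≡ = trans (cong₂ (iter rot) (sym |w|) a≡′) (trans (rots-pow x w) (sym a≡′))
    where
    a≡′ : a ≡ pow (suc x) w
    a≡′ = trans a≡ (cong (λ y → pow y w) (sym x≡))

repeatsWith⁺ : ∀ p a → 0 < length a → Repeats p a → repeatsWith p a ≡ true
repeatsWith⁺ (suc q′) a pos (repeats _ (divides zero    n≡) _) = ⊥-elim (<-irrefl (sym n≡) pos)
repeatsWith⁺ (suc q′) a pos (repeats _ (divides (suc x) n≡) fix) =
  cong₂ _∧_ (≡ᵇ-true (trans (cong (_% p) n≡) (m*n%n≡0 (suc x) p)))
            (≡⇒== (trans a≡ (cong (λ y → pow y u) (sym (trans (cong (_/ p) n≡) (m*n/n≡m (suc x) p))))))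
  where
  p = suc q′
  u = take p a
  v = drop p a
  p≤n : p ≤ length a
  p≤n = subst (p ≤_) (sym n≡) (m≤m+n p (x * p))
  |u| : length u ≡ p
  |u| = length-take-≤ p a p≤n
  comm : u ++ v ≡ v ++ u
  comm = trans (take++drop≡id p a) (sym (trans (rotate-rots p a p≤n) fix))
  |v| : length v ≡ x * length u
  |v| = trans (length-drop p a) (trans (cong (_∸ p) n≡)
          (trans (m+n∸m≡n p (x * p)) (cong (x *_) (sym |u|))))
  a≡ : a ≡ pow (suc x) u
  a≡ = trans (sym (take++drop≡id p a)) (cong (u ++_) (commute⇒pow x u v |v| comm))

search : Str → ℕ → ℕ → ℕ
search a p zero    = p
search a p (suc k) = if repeatsWith p a then p else search a (suc p) k

-- The search loop of `period` is a local function; the underscore in the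
-- type of `go≡search` stands for it.
period≡search : ∀ a → period a ≡ search a 1 (length a)
go≡search : ∀ a p k → _ ≡ search a p k

period≡search a with 1 | length a
... | p | k = go≡search a p k

go≡search a p zero    = refl
go≡search a p (suc k) with repeatsWith p a
... | true  = refl
... | false = go≡search a (suc p) k

search-≤ : ∀ a {q} → repeatsWith q a ≡ true → ∀ p k → p ≤ q → search a p k ≤ q
search-≤ a {q} e p zero    p≤q = p≤q
search-≤ a {q} e p (suc k) p≤q with repeatsWith p a in eq
... | true  = p≤q
... | false = search-≤ a e (suc p) k (≤∧≢⇒< p≤q λ { refl → true≢false (trans (sym e) eq) })

search-repeats : ∀ a {q} → repeatsWith q a ≡ true → ∀ p k → p ≤ q → q < p + k →
                 repeatsWith (search a p k) a ≡ true
search-repeats a {q} e p zero    p≤q q< = ⊥-elim (<⇒≱ q< (subst (_≤ q) (sym (+-identityʳ p)) p≤q))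
search-repeats a {q} e p (suc k) p≤q q< with repeatsWith p a in eq
... | true  = eq
... | false = search-repeats a e (suc p) k
                (≤∧≢⇒< p≤q λ { refl → true≢false (trans (sym e) eq) })
                (subst (q <_) (+-suc p k) q<)

repeats-length : ∀ a → 0 < length a → Repeats (length a) a
repeats-length a pos = repeats pos ∣-refl (rots-length a)

-- A failing search would end at the default `suc (length a)`. The length itself always qualifies,
-- so the default is not reached.
period-repeats : ∀ a → 0 < length a → Repeats (period a) a
period-repeats a pos = repeatsWith⁻ (period a) a pos
  (subst (λ p → repeatsWith p a ≡ true) (sym (period≡search a))
    (search-repeats a (repeatsWith⁺ _ a pos (repeats-length a pos)) 1 (length a) pos ≤-refl))

period-least : ∀ a {q} → 0 < length a → Repeats q a → period a ≤ q
period-least a {q} pos r@(repeats q>0 _ _) = subst (_≤ q) (sym (period≡search a))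
  (search-≤ a (repeatsWith⁺ q a pos r) 1 (length a) q>0)

period≤length : ∀ a → 0 < length a → period a ≤ length a
period≤length a pos = period-least a pos (repeats-length a pos)

repeats-rots : ∀ k {p a} → Repeats p a → Repeats p (iter rot k a)
repeats-rots k {p} {a} (repeats pos div fix) =
  repeats pos (subst (p ∣_) (sym (length-rots k a)) div) (trans (rots-comm p k a) (cong (iter rot k) fix))

period-rots : ∀ k a → 0 < length a → period (iter rot k a) ≡ period a
period-rots k a pos = ≤-antisym
  (period-least b pos′ (repeats-rots k (period-repeats a pos)))
  (period-least a pos (back (unrot k a)))
  where
  b = iter rot k a
  pos′ : 0 < length b
  pos′ = subst (0 <_) (sym (length-rots k a)) pos
  back : (∃ λ l → iter rot l b ≡ a) → Repeats (period b) a
  back (l , e) = subst (Repeats (period b)) e (repeats-rots l (period-repeats b pos′))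

rots-* : ∀ {d a} → iter rot d a ≡ a → ∀ q → iter rot (q * d) a ≡ a
rots-* {d} {a} fix zero    = refl
rots-* {d} {a} fix (suc q) = trans (iter-+ rot d (q * d) a) (trans (cong (iter rot d) (rots-* fix q)) fix)

-- The least positive shift fixing a divides the length, since the remainder
-- of the length by it fixes a as well.
period-least-shift : ∀ a {d} → 0 < length a → 0 < d → iter rot d a ≡ a → period a ≤ d
period-least-shift a {suc d} pos _ fix with least (λ k → iter rot (suc k) a ≟ₛ a) d fix
... | l , fixₗ , min = ≤-trans (period-least a pos (repeats z<s p∣n fixₗ)) l≤d
  where
  p = suc l
  n = length a
  l≤d : p ≤ suc d
  l≤d = ≮⇒≥ λ d<l → min d (≤-pred d<l) fix
  fixᵣ : iter rot (n % p) a ≡ a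
  fixᵣ = trans (cong (iter rot (n % p)) (sym (rots-* fixₗ (n / p))))
           (trans (sym (iter-+ rot (n % p) (n / p * p) a))
             (trans (cong (λ q → iter rot q a) (sym (m≡m%n+[m/n]*n n p))) (rots-length a)))
  zeroᵣ : ∀ r → r ≡ n % p → r ≡ 0
  zeroᵣ zero    _ = refl
  zeroᵣ (suc r) e = ⊥-elim (min r (≤-pred (subst (_< p) (sym e) (m%n<n n p)))
                      (subst (λ q → iter rot q a ≡ a) (sym e) fixᵣ))
  p∣n : p ∣ n
  p∣n = m%n≡0⇒n∣m n p (zeroᵣ (n % p) refl)

rots-<-period : ∀ a → 0 < length a → ∀ k → ∃ λ l → l < period a × iter rot l a ≡ iter rot k a
rots-<-period a pos k with period-repeats a pos
... | repeats p>0 _ fix = k % period a , m%n<n k (period a) ,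
    sym (trans (cong (λ q → iter rot q a) (m≡m%n+[m/n]*n k (period a)))
      (trans (iter-+ rot (k % period a) (k / period a * period a) a)
        (cong (iter rot (k % period a)) (rots-* fix (k / period a)))))
  where instance _ = >-nonZero p>0

rots-distinct : ∀ a → 0 < length a → ∀ {i j} → i < j → j < period a → iter rot i a ≢ iter rot j a
rots-distinct a pos {i} {j} i<j j<p e with unrot i a
... | l , e′ = <⇒≱ (≤-<-trans (m∸n≤m j i) j<p)
      (period-least-shift a pos (m<n⇒0<n∸m i<j) (begin
        iter rot (j ∸ i) a                         ≡⟨ cong (iter rot (j ∸ i)) (sym e′) ⟩
        iter rot (j ∸ i) (iter rot l (iter rot i a)) ≡⟨ rots-comm (j ∸ i) l _ ⟩
        iter rot l (iter rot (j ∸ i) (iter rot i a)) ≡⟨ cong (iter rot l) (sym (iter-+ rot (j ∸ i) i a)) ⟩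
        iter rot l (iter rot (j ∸ i + i) a)        ≡⟨ cong (λ q → iter rot l (iter rot q a)) (m∸n+n≡m (<⇒≤ i<j)) ⟩
        iter rot l (iter rot j a)                  ≡⟨ cong (iter rot l) (sym e) ⟩
        iter rot l (iter rot i a)                  ≡⟨ e′ ⟩
        a                                          ∎))
  where open ≡-Reasoning

-- Strings with bounded runs of zeros

zeros : ℕ → Str
zeros k = replicate k false

zeros-∷ʳ : ∀ k → zeros k ++ [ false ] ≡ zeros (suc k)
zeros-∷ʳ zero    = refl
zeros-∷ʳ (suc k) = cong (false ∷_) (zeros-∷ʳ k)

-- Every run of zeros has length at most p, and the initial one at most c.
data Runs (p : ℕ) : ℕ → Str → Set where
  end  : ∀ {c} → Runs p c []
  zero : ∀ {c v} → Runs p c v → Runs p (suc c) (false ∷ v)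
  one  : ∀ {c v} → Runs p p v → Runs p c (true ∷ v)

runs-weaken : ∀ {p c c′ v} → Runs p c v → c ≤ c′ → Runs p c′ v
runs-weaken end      _        = end
runs-weaken (zero r) (s≤s le) = zero (runs-weaken r le)
runs-weaken (one r)  _        = one r

runs-prefix : ∀ {p c} y z → Runs p c (y ++ z) → Runs p c y
runs-prefix []      z r        = end
runs-prefix (_ ∷ y) z (zero r) = zero (runs-prefix y z r)
runs-prefix (_ ∷ y) z (one r)  = one (runs-prefix y z r)

runs-suffix : ∀ {p c} y z → c ≤ p → Runs p c (y ++ z) → Runs p p z
runs-suffix []      z le r        = runs-weaken r le
runs-suffix (_ ∷ y) z le (zero r) = runs-suffix y z (<⇒≤ le) r
runs-suffix (_ ∷ y) z le (one r)  = runs-suffix y z ≤-refl r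

-- The 1 that closes the first factor keeps the runs on both sides of the seam apart.
runs-++ : ∀ {p c} x {y} → Runs p c (x ++ [ true ]) → Runs p p y → Runs p c ((x ++ [ true ]) ++ y)
runs-++ []      (one _)  ry = one ry
runs-++ (_ ∷ x) (zero r) ry = zero (runs-++ x r ry)
runs-++ (_ ∷ x) (one r)  ry = one (runs-++ x r ry)

-- In a rotation the two ends of the string meet behind its final 1, so no runs merge; the cut
-- elsewhere can only shorten a run.
runs-rots : ∀ {p} b → Runs p p (b ++ [ true ]) → ∀ k → Runs p p (iter rot k (b ++ [ true ]))
runs-rots {p} b r k with rots-< (b ++ [ true ]) (subst (0 <_) (sym (length-∷ʳ b true)) z<s) k
... | l , l< , e = subst (Runs p p) (trans (rotate-rots l w (<⇒≤ l<)) e) (rotated (snoc-view (drop l w) nonempty))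
  where
  w = b ++ [ true ]
  r′ : Runs p p (take l w ++ drop l w)
  r′ = subst (Runs p p) (sym (take++drop≡id l w)) r
  nonempty : 0 < length (drop l w)
  nonempty = subst (0 <_) (sym (length-drop l w)) (m<n⇒0<n∸m l<)
  rotated : (∃₂ λ x z → drop l w ≡ x ++ [ z ]) → Runs p p (rotate l w)
  rotated (x , z , eq) with ∷ʳ-injectiveʳ (take l w ++ x) b (begin
      (take l w ++ x) ++ [ z ] ≡⟨ ++-assoc (take l w) x [ z ] ⟩
      take l w ++ (x ++ [ z ]) ≡⟨ cong (take l w ++_) (sym eq) ⟩
      take l w ++ drop l w     ≡⟨ take++drop≡id l w ⟩
      b ++ [ true ]            ∎)
    where open ≡-Reasoning
  ... | refl = subst (λ d → Runs p p (d ++ take l w)) (sym eq)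
                 (runs-++ x (subst (Runs p p) eq (runs-suffix (take l w) (drop l w) ≤-refl r′))
                            (runs-prefix (take l w) (drop l w) r′))

runs-zeros : ∀ {p c} k w → k ≤ c → Runs p p w → Runs p c (zeros k ++ true ∷ w)
runs-zeros zero    w _        r = one r
runs-zeros (suc k) w (s≤s le) r = zero (runs-zeros k w le r)

weight-zeros-++ : ∀ k v → weight (zeros k ++ v) ≡ weight v
weight-zeros-++ zero    v = refl
weight-zeros-++ (suc k) v = weight-zeros-++ k v

zeros-one-min : ∀ k v → length v ≡ suc k → 0 < weight v → ((zeros k ++ [ true ]) ≤lex v) ≡ true
zeros-one-min zero    (true ∷ v)  _ _ = refl
zeros-one-min zero    (false ∷ []) _ ()
zeros-one-min (suc k) (true ∷ v)  _ _ = refl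
zeros-one-min (suc k) (false ∷ v) l w = zeros-one-min k v (suc-injective l) w

-- The weight is fixed so that, once all full blocks are matched, the rest of `v` still contains a 1
-- and cannot beat the closing 0ᵏ1.
LexMin : ℕ → Str → Set
LexMin p w = ∀ v → Runs p p v → length v ≡ length w → weight v ≡ weight w → (w ≤lex v) ≡ true

-- Either `v` shows a 1 before `c` zeros have passed and is larger, or it uses up its allowance of
-- `c` zeros, must continue with 1, and the remainder is compared by the minimality of `w`.
block-min : ∀ {p} w → LexMin p w → ∀ c v → Runs p c v →
            length v ≡ length (zeros c ++ true ∷ w) → weight v ≡ suc (weight w) →
            ((zeros c ++ true ∷ w) ≤lex v) ≡ true
block-min w min zero    (true ∷ v)  (one r)  l e = min v r (suc-injective l) (suc-injective e)
block-min w min (suc c) (true ∷ v)  (one r)  l e = refl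
block-min w min (suc c) (false ∷ v) (zero r) l e = block-min w min c v r (suc-injective l) e

blocks : ℕ → ℕ → Str
blocks p x = pow x (blk (suc p))

blocks-∷ : ∀ p x w → blocks p (suc x) ++ w ≡ zeros p ++ true ∷ (blocks p x ++ w)
blocks-∷ p x w = trans (++-assoc (blk (suc p)) (blocks p x) w) (++-assoc (zeros p) [ true ] _)

blocks-runs : ∀ p x k → k ≤ p → Runs p p (blocks p x ++ (zeros k ++ [ true ]))
blocks-runs p zero    k k≤p = runs-zeros k [] k≤p end
blocks-runs p (suc x) k k≤p = subst (Runs p p) (sym (blocks-∷ p x _))
                                (runs-zeros p _ ≤-refl (blocks-runs p x k k≤p))

blocks-min : ∀ p x k → LexMin p (blocks p x ++ (zeros k ++ [ true ]))
blocks-min p zero    k v r l e = zeros-one-min k v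
  (trans l (trans (length-∷ʳ (zeros k) true) (cong suc (length-replicate k))))
  (subst (0 <_) (sym (trans e (weight-zeros-++ k [ true ]))) z<s)
blocks-min p (suc x) k v r l e = subst (λ w → (w ≤lex v) ≡ true) (sym (blocks-∷ p x _))
  (block-min _ (blocks-min p x k) p v r (trans l (cong length (blocks-∷ p x _)))
    (trans e (trans (cong weight (blocks-∷ p x _)) (weight-zeros-++ p _))))

-- All rotations belong to the class over which `blocks-min` minimises: length and weight persist,
-- and so does the bound on runs because the string ends in 1.
blocks-necklace : ∀ p x k → k ≤ p → necklace ((blocks p x ++ zeros k) ++ [ true ]) ≡ true
blocks-necklace p x k k≤p = necklace⁺ w λ j →
  subst (λ u → (u ≤lex iter rot j w) ≡ true) (sym w≡)
    (blocks-min p x k (iter rot j w)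
      (runs-rots (blocks p x ++ zeros k) (subst (Runs p p) (sym w≡) (blocks-runs p x k k≤p)) j)
      (trans (length-rots j w) (cong length w≡)) (trans (weight-rots j w) (cong weight w≡)))
  where
  w = (blocks p x ++ zeros k) ++ [ true ]
  w≡ : w ≡ blocks p x ++ (zeros k ++ [ true ])
  w≡ = ++-assoc (blocks p x) (zeros k) [ true ]

longer-run-smaller : ∀ c p v w → c < p → ((zeros c ++ true ∷ v) ≤lex (zeros p ++ w)) ≡ false
longer-run-smaller zero    (suc p) v w _   = refl
longer-run-smaller (suc c) (suc p) v w c<p = longer-run-smaller c p v w (≤-pred c<p)

longer-run-not-necklace : ∀ c p w → c < p → necklace (zeros c ++ true ∷ (zeros p ++ w)) ≡ false
longer-run-not-necklace c p w c<p = not-true⇒false λ e → true≢false (trans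
  (sym (subst (λ u → (a ≤lex u) ≡ true) rotated (necklace⁻ a e (length b)))) (longer-run-smaller c p _ _ c<p))
  where
  b = zeros c ++ [ true ]
  a = zeros c ++ true ∷ (zeros p ++ w)
  a≡ : a ≡ b ++ (zeros p ++ w)
  a≡ = sym (++-assoc (zeros c) [ true ] _)
  rotated : iter rot (length b) a ≡ zeros p ++ (w ++ b)
  rotated = trans (cong (iter rot (length b)) a≡) (trans (rots-++ b (zeros p ++ w)) (++-assoc (zeros p) w b))

-- The strings γᵢ

-- The last n symbols of ⋯(0ᵖ1)(0ᵖ1)0ᵏ, so that γᵢ = comb (i ∸ 1) n 0 for i > 1.
comb : ℕ → ℕ → ℕ → Str
comb p zero    k       = []
comb p (suc n) zero    = comb p n p ++ [ true ]
comb p (suc n) (suc k) = comb p n k ++ [ false ]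

length-comb : ∀ p n k → length (comb p n k) ≡ n
length-comb p zero    k       = refl
length-comb p (suc n) zero    = trans (length-∷ʳ (comb p n p) true) (cong suc (length-comb p n p))
length-comb p (suc n) (suc k) = trans (length-∷ʳ (comb p n k) false) (cong suc (length-comb p n k))

-- Dropping the first symbol leaves a shorter suffix of the same left-infinite string. Appending 0
-- to it therefore is a shift from `k` to `suc k`.
comb-tail : ∀ p n k → ∃ λ a → comb p (suc n) k ≡ a ∷ comb p n k
comb-tail p zero    zero    = true , refl
comb-tail p zero    (suc k) = false , refl
comb-tail p (suc n) zero    = map₂ (cong (_++ [ true ])) (comb-tail p n p)
comb-tail p (suc n) (suc k) = map₂ (cong (_++ [ false ])) (comb-tail p n k)

comb-zeros : ∀ p n c k → comb p (k + n) (k + c) ≡ comb p n c ++ zeros k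
comb-zeros p n c zero    = sym (++-identityʳ _)
comb-zeros p n c (suc k) = begin
  comb p (k + n) (k + c) ++ [ false ]     ≡⟨ cong (_++ [ false ]) (comb-zeros p n c k) ⟩
  (comb p n c ++ zeros k) ++ [ false ]    ≡⟨ ++-assoc (comb p n c) (zeros k) [ false ] ⟩
  comb p n c ++ (zeros k ++ [ false ])    ≡⟨ cong (comb p n c ++_) (zeros-∷ʳ k) ⟩
  comb p n c ++ zeros (suc k)             ∎
  where open ≡-Reasoning

comb-blocks : ∀ p n x → comb p (x * suc p + n) 0 ≡ comb p n 0 ++ blocks p x
comb-blocks p n zero    = sym (++-identityʳ _)
comb-blocks p n (suc x) = begin
  comb p (suc p + x * suc p + n) 0          ≡⟨ cong (λ q → comb p q 0) (+-assoc (suc p) (x * suc p) n) ⟩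
  comb p (p + N) p ++ [ true ]              ≡⟨ cong (λ q → comb p (p + N) q ++ [ true ]) (sym (+-identityʳ p)) ⟩
  comb p (p + N) (p + 0) ++ [ true ]        ≡⟨ cong (_++ [ true ]) (comb-zeros p N 0 p) ⟩
  (comb p N 0 ++ zeros p) ++ [ true ]       ≡⟨ ++-assoc (comb p N 0) (zeros p) [ true ] ⟩
  comb p N 0 ++ blk (suc p)                 ≡⟨ cong (_++ blk (suc p)) (comb-blocks p n x) ⟩
  (comb p n 0 ++ blocks p x) ++ blk (suc p) ≡⟨ ++-assoc (comb p n 0) (blocks p x) _ ⟩
  comb p n 0 ++ (blocks p x ++ blk (suc p)) ≡⟨ cong (comb p n 0 ++_) (pow-comm x (blk (suc p))) ⟩
  comb p n 0 ++ blocks p (suc x)            ∎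
  where
  open ≡-Reasoning
  N = x * suc p + n

comb-start : ∀ p c → c ≤ p → comb p (suc c) 0 ≡ zeros c ++ [ true ]
comb-start p c c≤p = cong (_++ [ true ]) (begin
  comb p c p                    ≡⟨ cong₂ (comb p) (sym (+-identityʳ c)) (sym (m+[n∸m]≡n c≤p)) ⟩
  comb p (c + 0) (c + (p ∸ c))  ≡⟨ comb-zeros p 0 (p ∸ c) c ⟩
  zeros c                       ∎)
  where open ≡-Reasoning

record CombForm (p n k : ℕ) : Set where
  constructor combForm
  field
    c x    : ℕ
    c≤p    : c ≤ p
    n≡     : n ≡ k + (x * suc p + suc c)
    shape  : comb p n k ≡ zeros c ++ true ∷ (blocks p x ++ zeros k)

comb-form : ∀ p n k → k < n → CombForm p n k
comb-form p n k k<n = combForm c x (≤-pred (m%n<n N (suc p))) n≡ (begin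
    comb p n k                                    ≡⟨ cong₂ (comb p) n≡ (sym (+-identityʳ k)) ⟩
    comb p (k + (x * suc p + suc c)) (k + 0)      ≡⟨ comb-zeros p _ 0 k ⟩
    comb p (x * suc p + suc c) 0 ++ zeros k       ≡⟨ cong (_++ zeros k) (comb-blocks p (suc c) x) ⟩
    (comb p (suc c) 0 ++ blocks p x) ++ zeros k   ≡⟨ ++-assoc (comb p (suc c) 0) (blocks p x) (zeros k) ⟩
    comb p (suc c) 0 ++ (blocks p x ++ zeros k)   ≡⟨ cong (_++ (blocks p x ++ zeros k)) (comb-start p c (≤-pred (m%n<n N (suc p)))) ⟩
    (zeros c ++ [ true ]) ++ (blocks p x ++ zeros k) ≡⟨ ++-assoc (zeros c) [ true ] _ ⟩
    zeros c ++ true ∷ (blocks p x ++ zeros k)     ∎)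
  where
  open ≡-Reasoning
  -- Taking away the `k` final zeros and the leading 1 leaves the `c` initial zeros and `x` whole
  -- blocks of length `suc p`.
  N = n ∸ suc k
  c = N % suc p
  x = N / suc p
  n≡ : n ≡ k + (x * suc p + suc c)
  n≡ = begin
    n                           ≡⟨ sym (m+[n∸m]≡n k<n) ⟩
    suc k + N                   ≡⟨ sym (+-suc k N) ⟩
    k + suc N                   ≡⟨ cong (λ q → k + suc q) (trans (m≡m%n+[m/n]*n N (suc p)) (+-comm c (x * suc p))) ⟩
    k + suc (x * suc p + c)     ≡⟨ cong (k +_) (sym (+-suc (x * suc p) c)) ⟩
    k + (x * suc p + suc c)     ∎

gamma≡comb : ∀ n q → gamma n (suc (suc q)) ≡ comb (suc q) n 0
gamma≡comb n q with n % suc (suc q) in eq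
... | zero = sym (begin
    comb p n 0                    ≡⟨ cong (λ l → comb p l 0) n≡ ⟩
    comb p (x * suc p + 0) 0      ≡⟨ comb-blocks p 0 x ⟩
    blocks p x                    ∎)
  where
  open ≡-Reasoning
  p = suc q
  x = n / suc p
  n≡ : n ≡ x * suc p + 0
  n≡ = trans (m≡m%n+[m/n]*n n (suc p)) (trans (cong (_+ x * suc p) eq) (+-comm 0 (x * suc p)))
... | suc y = sym (begin
    comb p n 0                               ≡⟨ cong (λ l → comb p l 0) n≡ ⟩
    comb p (x * suc p + suc y) 0             ≡⟨ comb-blocks p (suc y) x ⟩
    comb p (suc y) 0 ++ blocks p x           ≡⟨ cong (_++ blocks p x) (comb-start p y y≤p) ⟩
    (zeros y ++ [ true ]) ++ blocks p x      ≡⟨ ++-assoc (zeros y) [ true ] _ ⟩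
    zeros y ++ true ∷ blocks p x             ∎)
  where
  open ≡-Reasoning
  p = suc q
  x = n / suc p
  y≤p : y ≤ p
  y≤p = <⇒≤ (≤-pred (subst (_< suc p) eq (m%n<n n (suc p))))
  n≡ : n ≡ x * suc p + suc y
  n≡ = trans (m≡m%n+[m/n]*n n (suc p)) (trans (cong (_+ x * suc p) eq) (+-comm (suc y) (x * suc p)))

-- By `comb-form` the state is 0ᶜ1(0ᵖ1)ˣ0ᵏ. For c = 0 it starts with 1 and the tested string
-- (0ᵖ1)ˣ0ᵏ1 is a necklace, so PCR3 complements the 1. For c > 0 it starts with 0 and the tested
-- string starts with only c - 1 < p zeros but has the run 0ᵖ further on, so PCR3 keeps the 0. That
-- run is the first block, or for x = 0 the final 0ᵏ, where `suc (p + p) ≤ n` forces k = p.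
comb-PCR3 : ∀ p n k → 1 ≤ p → k ≤ p → suc (p + p) ≤ n → PCR3 (comb p n k) ≡ false
comb-PCR3 p n k 1≤p k≤p big with comb-form p n k (≤-trans (s≤s (≤-trans k≤p (m≤m+n p p))) big)
... | combForm zero    x c≤p n≡ shape rewrite shape | blocks-necklace p x k k≤p = refl
... | combForm (suc c) x c≤p n≡ shape rewrite shape =
    cong (λ b → if b then true else false) (not-necklace x n≡)
  where
  not-necklace : ∀ x → n ≡ k + (x * suc p + suc (suc c)) →
    necklace ((zeros c ++ true ∷ (blocks p x ++ zeros k)) ++ [ true ]) ≡ false
  not-necklace zero n≡ = trans (cong necklace (begin
      (zeros c ++ true ∷ zeros k) ++ [ true ] ≡⟨ ++-assoc (zeros c) _ [ true ] ⟩
      zeros c ++ true ∷ (zeros k ++ [ true ]) ≡⟨ cong (λ l → zeros c ++ true ∷ (zeros l ++ [ true ])) k≡p ⟩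
      zeros c ++ true ∷ (zeros p ++ [ true ]) ∎)) (longer-run-not-necklace c p [ true ] c≤p)
    where
    open ≡-Reasoning
    k≡p : k ≡ p
    k≡p = ≤-antisym k≤p (+-cancelʳ-≤ (suc p) p k
            (≤-trans (≤-reflexive (+-suc p p)) (≤-trans big (≤-trans (≤-reflexive n≡) (+-monoʳ-≤ k (s≤s c≤p))))))
  not-necklace (suc x) n≡ = trans (cong necklace (begin
      (zeros c ++ true ∷ (blocks p (suc x) ++ zeros k)) ++ [ true ]
        ≡⟨ ++-assoc (zeros c) _ [ true ] ⟩
      zeros c ++ true ∷ ((blocks p (suc x) ++ zeros k) ++ [ true ])
        ≡⟨ cong (λ l → zeros c ++ true ∷ (l ++ [ true ])) (blocks-∷ p x (zeros k)) ⟩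
      zeros c ++ true ∷ ((zeros p ++ true ∷ (blocks p x ++ zeros k)) ++ [ true ])
        ≡⟨ cong (λ l → zeros c ++ true ∷ l) (++-assoc (zeros p) _ [ true ]) ⟩
      zeros c ++ true ∷ (zeros p ++ true ∷ (blocks p x ++ zeros k) ++ [ true ]) ∎))
      (longer-run-not-necklace c p _ c≤p)
    where open ≡-Reasoning

-- Both strings are read from the right. Either neither contains a 1, or their last 1s coincide and
-- what stands before is again a pair of combs.
comb-injective-step : ∀ {p p′} n k k′ → comb p n k ≡ comb p′ n k′ →
  (n ≤ k × n ≤ k′) ⊎ (k ≡ k′ × ∃ λ N → n ≡ suc (k + N) × comb p N p ≡ comb p′ N p′)
comb-injective-step zero    k k′ e = inj₁ (z≤n , z≤n)
comb-injective-step {p} {p′} (suc n) zero zero e = inj₂ (refl , n , refl , ∷ʳ-injectiveˡ (comb p n p) _ e)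
comb-injective-step {p} {p′} (suc n) zero (suc k′) e =
  ⊥-elim (true≢false (∷ʳ-injectiveʳ (comb p n p) (comb p′ n k′) e))
comb-injective-step {p} {p′} (suc n) (suc k) zero e =
  ⊥-elim (true≢false (sym (∷ʳ-injectiveʳ (comb p n k) (comb p′ n p′) e)))
comb-injective-step {p} {p′} (suc n) (suc k) (suc k′) e
  with comb-injective-step n k k′ (∷ʳ-injectiveˡ (comb p n k) (comb p′ n k′) e)
... | inj₁ (l , l′)              = inj₁ (s≤s l , s≤s l′)
... | inj₂ (refl , N , refl , e′) = inj₂ (refl , N , refl , e′)

-- The last 1 determines `k`, the one before it `p`. If there is no second 1, then N ≤ p and N ≤ p′,
-- and 2p ≤ k + N ≤ 2p′ holds together with its mirror image.
comb-injective : ∀ {p p′ n k k′} → k ≤ p → k′ ≤ p′ → suc (p + p) ≤ n → suc (p′ + p′) ≤ n →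
                 comb p n k ≡ comb p′ n k′ → p ≡ p′ × k ≡ k′
comb-injective {p} {p′} {n} {k} {k′} k≤p k′≤p′ big big′ e with comb-injective-step n k k′ e
... | inj₁ (n≤k , _) = ⊥-elim (<⇒≱ (≤-trans (s≤s (≤-trans k≤p (m≤m+n p p))) big) n≤k)
... | inj₂ (refl , N , refl , e′) with comb-injective-step N p p′ e′
...   | inj₂ (p≡p′ , _)  = p≡p′ , refl
...   | inj₁ (N≤p , N≤p′) = ≤-antisym (half big k′≤p′ N≤p′) (half big′ k≤p N≤p) , refl
  where
  half : ∀ {a b} → suc (a + a) ≤ suc (k + N) → k ≤ b → N ≤ b → a ≤ b
  half {a} {b} le kb Nb = ≮⇒≥ λ b<a → <⇒≱ (+-mono-< b<a b<a) (≤-trans (≤-pred le) (+-mono-≤ kb Nb))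

-- The set S and the joining of its PCR cycles

inT⁺ : ∀ {reps r} b → 0 < length b → r ∈ reps → ∀ k → iter rot k b ≡ r → inT reps b ≡ true
inT⁺ {reps} {r} b pos r∈ k e with rots-< b pos k
... | l , l< , e′ = any-true⁺ (λ r → any (λ i → rotate i b == r) (upTo (length b))) r∈
      (any-true⁺ (λ i → rotate i b == r) (∈-upTo⁺ l<) (≡⇒== (trans (rotate-rots l b (<⇒≤ l<)) (trans e′ e))))

inT⁻ : ∀ {reps} b → inT reps b ≡ true → ∃ λ r → r ∈ reps × ∃ λ k → iter rot k b ≡ r
inT⁻ {reps} b e with any-true⁻ (λ r → any (λ i → rotate i b == r) (upTo (length b))) reps e
... | r , r∈ , e′ with any-true⁻ (λ i → rotate i b == r) (upTo (length b)) e′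
...   | i , i∈ , e″ = r , r∈ , i , trans (sym (rotate-rots i b (<⇒≤ (∈-upTo⁻ i∈)))) (==⇒≡ e″)

module Joined (n-1 m h : ℕ) (reps : List Str)
              (reps-weight : ∀ {r} → r ∈ reps → weight r ≡ m) where

  n : ℕ
  n = suc n-1

  data Kind (b : Str) : Set where
    light  : weight b < m → Kind b
    short  : weight b ≡ m → period b < h → Kind b
    chosen : ∀ {r} → r ∈ reps → ∀ k → iter rot k b ≡ r → Kind b

  record S (b : Str) : Set where
    constructor inside
    field
      size   : length b ≡ n
      member : inS m h reps b ≡ true

  open S

  S⁺ : ∀ {b} → length b ≡ n → Kind b → S b
  S⁺ {b} l (light lt)       = inside l (∨-trueˡ (<ᵇ-true lt))
  S⁺ {b} l (short e p)      = inside l (∨-trueʳ {weight b <ᵇ m} (∨-trueˡ (cong₂ _∧_ (≡ᵇ-true e) (<ᵇ-true p))))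
  S⁺ {b} l (chosen r∈ k e)  = inside l (∨-trueʳ {weight b <ᵇ m} (∨-trueʳ {(weight b ≡ᵇ m) ∧ (period b <ᵇ h)}
                                (inT⁺ b (subst (0 <_) (sym l) z<s) r∈ k e)))

  S⁻ : ∀ {b} → S b → Kind b
  S⁻ {b} (inside l e) with ∨-true⁻ {weight b <ᵇ m} e
  ... | inj₁ lt = light (<ᵇ-true⁻ lt)
  ... | inj₂ e′ with ∨-true⁻ {(weight b ≡ᵇ m) ∧ (period b <ᵇ h)} e′
  ...   | inj₁ sh = short (≡ᵇ-true⁻ (proj₁ (∧-true⁻ sh))) (<ᵇ-true⁻ (proj₂ (∧-true⁻ {weight b ≡ᵇ m} sh)))
  ...   | inj₂ t with inT⁻ b t
  ...     | r , r∈ , k , eq = chosen r∈ k eq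

  S? : ∀ {b} → length b ≡ n → S b ⊎ inS m h reps b ≡ false
  S? {b} l with true-or-false (inS m h reps b)
  ... | inj₁ eq = inj₁ (inside l eq)
  ... | inj₂ eq = inj₂ eq

  S-rots : ∀ k {b} → S b → S (iter rot k b)
  S-rots k {b} sb@(inside l _) with S⁻ sb
  ... | light lt  = S⁺ (trans (length-rots k b) l) (light (subst (_< m) (sym (weight-rots k b)) lt))
  ... | short e p = S⁺ (trans (length-rots k b) l) (short (trans (weight-rots k b) e)
                      (subst (_< h) (sym (period-rots k b (subst (0 <_) (sym l) z<s))) p))
  ... | chosen r∈ j e with unrot k b
  ...   | i , e′ = S⁺ (trans (length-rots k b) l)
                     (chosen r∈ (j + i) (trans (iter-+ rot j i _) (trans (cong (iter rot j) e′) e)))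

  S-weight : ∀ {b} → S b → weight b ≤ m
  S-weight {b} sb with S⁻ sb
  ... | light lt      = <⇒≤ lt
  ... | short e _     = ≤-reflexive e
  ... | chosen r∈ k e = ≤-reflexive (trans (sym (weight-rots k b)) (trans (cong weight e) (reps-weight r∈)))

  S-lighter : ∀ {a b} → S a → length b ≡ n → weight b < weight a → S b
  S-lighter sa l lt = S⁺ l (light (<-≤-trans lt (S-weight sa)))

  S-∷ʳ-false : ∀ a {u} → S (a ∷ u) → S (u ++ [ false ])
  S-∷ʳ-false false     s         = S-rots 1 s
  S-∷ʳ-false true  {u} s@(inside l _) = S-lighter s (trans (length-∷ʳ u false) l)
                                     (s≤s (≤-reflexive (weight-∷ʳ-false u)))

  S-conj : ∀ {u} → S (u ++ [ true ]) → S (u ++ [ false ])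
  S-conj {u} s@(inside l _) = S-lighter s (trans (length-∷ʳ u false) (trans (sym (length-∷ʳ u true)) l))
    (subst₂ _<_ (sym (weight-∷ʳ-false u)) (sym (weight-∷ʳ-true u)) ≤-refl)

  -- Joining the PCR cycles contained in S, without shortening the result.
  g : Str → Str
  g = step n m h 0 reps

  g-in : ∀ a u {x} → PCR3 (a ∷ u) ≡ x → S (u ++ [ x ]) → g (a ∷ u) ≡ u ++ [ x ]
  g-in a u refl (inside _ e) rewrite e = refl

  g-out : ∀ a u {x} → PCR3 (a ∷ u) ≡ x → inS m h reps (u ++ [ x ]) ≡ false → g (a ∷ u) ≡ u ++ [ not x ]
  g-out a u refl e rewrite e = refl

  PCR3-necklace : ∀ a u → necklace (u ++ [ true ]) ≡ true → PCR3 (a ∷ u) ≡ not a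
  PCR3-necklace a u e rewrite e = refl

  PCR3-other : ∀ a u → necklace (u ++ [ true ]) ≡ false → PCR3 (a ∷ u) ≡ a
  PCR3-other a u e rewrite e = refl

  g-child : ∀ u → necklace (u ++ [ true ]) ≡ true → S (u ++ [ true ]) → g (false ∷ u) ≡ u ++ [ true ]
  g-child u nk s = g-in false u (PCR3-necklace false u nk) s

  g-parent : ∀ u → necklace (u ++ [ true ]) ≡ true → S (u ++ [ false ]) → g (true ∷ u) ≡ u ++ [ false ]
  g-parent u nk s = g-in true u (PCR3-necklace true u nk) s

  g-rot : ∀ a u → necklace (u ++ [ true ]) ≡ false → S (a ∷ u) → g (a ∷ u) ≡ u ++ [ a ]
  g-rot a u nk s = g-in a u (PCR3-other a u nk) (S-rots 1 s)

  g-S : ∀ {x} → S x → S (g x)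
  g-S {a ∷ u} s with true-or-false (necklace (u ++ [ true ]))
  ... | inj₂ nk = subst S (sym (g-rot a u nk s)) (S-rots 1 s)
  g-S {true ∷ u} s | inj₁ nk = subst S (sym (g-parent u nk (S-∷ʳ-false true s))) (S-∷ʳ-false true s)
  g-S {false ∷ u} s@(inside l _) | inj₁ nk with S? (trans (length-∷ʳ u true) l)
  ... | inj₁ s′ = subst S (sym (g-child u nk s′)) s′
  ... | inj₂ ¬s = subst S (sym (g-out false u (PCR3-necklace false u nk) ¬s)) (S-rots 1 s)

  -- With both conjugates in S their rotations u0 and u1 are in S too. So neither successor is
  -- corrected, and PCR3 takes different values on the two.
  g-conj : ∀ u → S (false ∷ u) → S (true ∷ u) → g (false ∷ u) ≢ g (true ∷ u)
  g-conj u s₀ s₁ e with true-or-false (necklace (u ++ [ true ]))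
  ... | inj₁ nk = true≢false (∷ʳ-injectiveʳ u u
                  (trans (sym (g-child u nk (S-rots 1 s₁))) (trans e (g-parent u nk (S-rots 1 s₀)))))
  ... | inj₂ nk = true≢false (sym (∷ʳ-injectiveʳ u u
                  (trans (sym (g-rot false u nk s₀)) (trans e (g-rot true u nk s₁)))))

  g-injective : ∀ {x y} → S x → S y → g x ≡ g y → x ≡ y
  g-injective {a ∷ u} {b ∷ v} sx sy e with ∷ʳ-injectiveˡ u v e
  g-injective {true  ∷ u} {true  ∷ u} sx sy e | refl = refl
  g-injective {true  ∷ u} {false ∷ u} sx sy e | refl = ⊥-elim (g-conj u sy sx (sym e))
  g-injective {false ∷ u} {true  ∷ u} sx sy e | refl = ⊥-elim (g-conj u sx sy e)
  g-injective {false ∷ u} {false ∷ u} sx sy e | refl = refl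

  -- The excursions of g into heavier cycles return to where they left, so
  -- from its necklace g reaches the whole PCR cycle.
  rots-reachable : ∀ d b → necklace (b ++ [ true ]) ≡ true → S (b ++ [ true ]) →
                   m ≤ d + weight (b ++ [ true ]) → ∀ q → Reach g (b ++ [ true ]) (iter rot q (b ++ [ true ]))
  rots-reachable d b nb sb hd zero    = 0 , refl
  rots-reachable d b nb sb hd (suc q) with rots-reachable d b nb sb hd q
  ... | to-r with iter rot q (b ++ [ true ]) in eq
  ... | []    = to-r
  ... | a ∷ u with subst S eq (S-rots q sb) | true-or-false (necklace (u ++ [ true ]))
  ... | sr | inj₂ nk = reach-trans to-r (reach-step (g-rot a u nk sr))
  -- The next rotation is a necklace on the cycle of b1, hence b1 itself: the round is complete and
  -- no step remains.
  rots-reachable d b nb sb hd (suc q) | to-r | true ∷ u | sr | inj₁ nk =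
    0 , necklace-unique (b ++ [ true ]) (u ++ [ true ]) nb nk (suc q) (cong rot eq)
  rots-reachable d b nb sb hd (suc q) | to-r | false ∷ u | sr | inj₁ nk
    with S? (trans (length-∷ʳ u true) (size sr))
  ... | inj₂ ¬s = reach-trans to-r (reach-step (g-out false u (PCR3-necklace false u nk) ¬s))
  ... | inj₁ su = reach-trans to-r (reach-trans (reach-step (g-child u nk su))
                    (reach-trans (below d hd) (reach-step (g-parent u nk (S-rots 1 sr)))))
    where
    heavier : weight (u ++ [ true ]) ≡ suc (weight (b ++ [ true ]))
    heavier = trans (weight-∷ʳ-true u) (cong suc (trans (cong weight (sym eq)) (weight-rots q (b ++ [ true ]))))
    -- `d` bounds the depth still possible: each descent adds 1 to the weight, which is at most `m`
    -- in S, so `zero` cannot occur.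
    below : ∀ d → m ≤ d + weight (b ++ [ true ]) → Reach g (u ++ [ true ]) (true ∷ u)
    below zero    hd = ⊥-elim (<⇒≱ (subst (m <_) (sym heavier) (s≤s hd)) (S-weight su))
    below (suc d) hd = subst (Reach g (u ++ [ true ])) (rots-∷ʳ u true)
      (rots-reachable d u nk su (subst (m ≤_) (trans (sym (+-suc d _)) (cong (d +_) (sym heavier))) hd) (length u))

  zero-string : ∀ {b} → length b ≡ n → weight b ≡ 0 → zeros n ≡ b
  zero-string {b} l w = trans (cong zeros (sym l)) (sym (weight-zero b w))

  -- Induction along the path to the root: if b1 is the necklace of `y`, then 0b is lighter, lies in
  -- S and has b1 as its successor, and from b1 the whole cycle is reached.
  reachable : ∀ w {y} → S y → weight y ≤ w → Reach g (zeros n) y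
  reachable zero    {y} s@(inside l _) hw = 0 , zero-string l (n≤0⇒n≡0 hw)
  reachable (suc w) {y} s@(inside l _) hw with weight y ≟ 0
  ... | yes w0 = 0 , zero-string l w0
  ... | no  w≢0 with necklace-exists y
  ...   | k , nk with necklace-ends-true (iter rot k y) nk (subst (0 <_) (sym (weight-rots k y)) (n≢0⇒n>0 w≢0)) | unrot k y
  ...     | b , e | l′ , back = reach-trans (reachable w s₀ w₀)
              (reach-trans (reach-step (g-child b nb sb))
                (subst (Reach g (b ++ [ true ])) (trans (cong (iter rot l′) (sym e)) back)
                  (rots-reachable m b nb sb (m≤m+n m _) l′)))
    where
    nb : necklace (b ++ [ true ]) ≡ true
    nb = subst (λ c → necklace c ≡ true) e nk
    sb : S (b ++ [ true ])
    sb = subst S e (S-rots k s)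
    wb : suc (weight b) ≡ weight y
    wb = trans (sym (weight-∷ʳ-true b)) (trans (cong weight (sym e)) (weight-rots k y))
    s₀ : S (false ∷ b)
    s₀ = S-lighter sb (trans (sym (length-∷ʳ b true)) (size sb)) (subst (weight b <_) (sym (weight-∷ʳ-true b)) ≤-refl)
    w₀ : weight b ≤ w
    w₀ = ≤-pred (subst (_≤ suc w) (sym wb) hw)

  α₀ : Str
  α₀ = zeros n-1 ++ [ true ]

  α₀-necklace : necklace α₀ ≡ true
  α₀-necklace = blocks-necklace n-1 0 n-1 ≤-refl

  module _ (s₀ : S α₀) where

    zeros-S : S (zeros n)
    zeros-S = subst S (zeros-∷ʳ n-1) (S-conj s₀)

    g-zeros : g (zeros n) ≡ α₀
    g-zeros = g-child (zeros n-1) α₀-necklace s₀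

    -- The cycle of `α₀` is left at 10ⁿ⁻¹ towards 0ⁿ, from which all of S is reached. A positive
    -- number of steps is demanded so that the case `y = α₀` expresses the return.
    α₀-reaches : ∀ {y} → S y → ∃ λ k → iter g (suc k) α₀ ≡ y
    α₀-reaches {y} sy with rots-reachable m (zeros n-1) α₀-necklace s₀ (m≤m+n m _) (length (zeros n-1))
                       | reachable (weight y) sy ≤-refl
    ... | j , e | k , e′ = k + j , (begin
        iter g (suc (k + j)) α₀              ≡⟨ cong (λ q → iter g q α₀) (sym (+-suc k j)) ⟩
        iter g (k + suc j) α₀                ≡⟨ iter-+ g k (suc j) α₀ ⟩
        iter g k (g (iter g j α₀))           ≡⟨ cong (λ c → iter g k (g c)) (trans e (rots-∷ʳ (zeros n-1) true)) ⟩
        iter g k (g (true ∷ zeros n-1))      ≡⟨ cong (iter g k) (trans (g-parent (zeros n-1) α₀-necklace (S-conj s₀)) (zeros-∷ʳ n-1)) ⟩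
        iter g k (zeros n)                   ≡⟨ e′ ⟩
        y                                    ∎)
      where open ≡-Reasoning

-- The i strings skipped when the successor γᵢ is flipped; they are i
-- consecutive states of g, the first one being γᵢ.
seg : ℕ → ℕ → ℕ → Str
seg n zero          k = []
seg n (suc zero)    k = zeros n
seg n (suc (suc q)) k = comb (suc q) n k

gamma≡seg : ∀ n i → gamma n i ≡ seg n i 0
gamma≡seg n zero          = refl
gamma≡seg n (suc zero)    = refl
gamma≡seg n (suc (suc q)) = gamma≡comb n q

comb-weight : ∀ p n k → k < n → 0 < weight (comb p n k)
comb-weight p n k k<n with comb-form p n k k<n
... | combForm c x _ _ shape =
  subst (0 <_) (sym (trans (cong weight shape) (weight-zeros-++ c _))) z<s

-- Cutting the segments out of the joined cycle

module Shortened (n-1 m h : ℕ) (reps : List Str) (reps-weight : ∀ {r} → r ∈ reps → weight r ≡ m)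
  (s₀ : Joined.S n-1 m h reps reps-weight (zeros n-1 ++ [ true ]))
  (s : ℕ) (Is : List ℕ)
  (Is-bounds : ∀ {i} → i ∈ Is → 0 < i × i + i ≤ suc (suc n-1))
  (Is-S : ∀ {i} → i ∈ Is → Joined.S n-1 m h reps reps-weight (gamma (suc n-1) i))
  (inR⁻ : ∀ b → inR (suc n-1) s b ≡ true → ∃ λ i → i ∈ Is × b ≡ gamma (suc n-1) i)
  (inR⁺ : ∀ {i} → i ∈ Is → inR (suc n-1) s (gamma (suc n-1) i) ≡ true) where

  open Joined n-1 m h reps reps-weight

  f : Str → Str
  f = step n m h s reps

  f-jump : ∀ a u → inS m h reps (u ++ [ PCR3 (a ∷ u) ]) ≡ true → inR n s (u ++ [ PCR3 (a ∷ u) ]) ≡ true →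
           f (a ∷ u) ≡ u ++ [ not (PCR3 (a ∷ u)) ]
  f-jump a u eS eR rewrite eS | eR = refl

  f-same : ∀ a u → inR n s (u ++ [ PCR3 (a ∷ u) ]) ≡ false → f (a ∷ u) ≡ g (a ∷ u)
  f-same a u eR rewrite eR = refl

  comb-bound : ∀ {q} → suc (suc q) + suc (suc q) ≤ suc n → suc (suc q + suc q) ≤ n
  comb-bound {q} le = subst (_≤ n) (+-suc (suc q) (suc q)) (≤-pred le)

  -- The case `k = suc q` is included: it leads from the last skipped string to γᵢ with its final 1
  -- turned into 0, the target of the jump.
  comb-next : ∀ {q k} → suc (suc q) + suc (suc q) ≤ suc n → k ≤ suc q → S (comb (suc q) n k) →
              g (comb (suc q) n k) ≡ comb (suc q) n (suc k)
  comb-next {q} {k} le k≤ sk with comb-tail (suc q) n-1 k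
  ... | a , e = trans (cong g e) (g-in a (comb (suc q) n-1 k)
                  (trans (cong PCR3 (sym e)) (comb-PCR3 (suc q) n k z<s k≤ (comb-bound le)))
                  (S-∷ʳ-false a (subst S e sk)))

  seg-S : ∀ {i} → i ∈ Is → ∀ k → k < i → S (seg n i k)
  seg-next : ∀ {i} → i ∈ Is → ∀ k → suc k < i → g (seg n i k) ≡ seg n i (suc k)

  seg-S {i} i∈ zero    _  = subst S (gamma≡seg n i) (Is-S i∈)
  seg-S {i} i∈ (suc k) k< = subst S (seg-next i∈ k k<) (g-S (seg-S i∈ k (<⇒≤ k<)))

  seg-next {suc zero}    i∈ k (s≤s ())
  seg-next {suc (suc q)} i∈ k k< = comb-next (proj₂ (Is-bounds i∈)) (<⇒≤ (≤-pred k<)) (seg-S i∈ k (<⇒≤ k<))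

  comb-short : ∀ {q} → suc (suc q) + suc (suc q) ≤ suc n → suc q < n-1
  comb-short {q} le = ≤-trans (s≤s (s≤s (m≤n+m q q))) (≤-trans (≤-reflexive (cong suc (sym (+-suc q q)))) (≤-pred (comb-bound le)))

  zeros≢comb : ∀ {q k} → suc (suc q) + suc (suc q) ≤ suc n → k ≤ suc q → zeros n ≢ comb (suc q) n k
  zeros≢comb {q} {k} le k≤ e = <-irrefl (sym (trans (cong weight (sym e)) (weight-replicate-false n)))
    (comb-weight (suc q) n k (s≤s (≤-trans k≤ (<⇒≤ (comb-short le)))))

  zeros≢comb-∷ʳ : ∀ {q} → suc (suc q) + suc (suc q) ≤ suc n → zeros n-1 ≢ comb (suc q) n-1 (suc q)
  zeros≢comb-∷ʳ {q} le e = <-irrefl (sym (trans (cong weight (sym e)) (weight-replicate-false n-1)))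
    (comb-weight (suc q) n-1 (suc q) (comb-short le))

  seg-injective : ∀ {i i′ k k′} → i ∈ Is → i′ ∈ Is → k < i → k′ < i′ →
                  seg n i k ≡ seg n i′ k′ → i ≡ i′ × k ≡ k′
  seg-injective {suc zero} {suc zero} _ _ (s≤s z≤n) (s≤s z≤n) e = refl , refl
  seg-injective {suc zero} {suc (suc q)} _ i′∈ _ k′< e =
    ⊥-elim (zeros≢comb (proj₂ (Is-bounds i′∈)) (≤-pred k′<) e)
  seg-injective {suc (suc q)} {suc zero} i∈ _ k< _ e =
    ⊥-elim (zeros≢comb (proj₂ (Is-bounds i∈)) (≤-pred k<) (sym e))
  seg-injective {suc (suc q)} {suc (suc q′)} i∈ i′∈ k< k′< e
    with comb-injective (≤-pred k<) (≤-pred k′<) (comb-bound (proj₂ (Is-bounds i∈))) (comb-bound (proj₂ (Is-bounds i′∈))) e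
  ... | refl , refl = refl , refl

  Good : Str → Set
  Good x = S x × (∀ {i k} → i ∈ Is → k < i → x ≢ seg n i k)

  α₀≢zeros : α₀ ≢ zeros n
  α₀≢zeros e = true≢false (∷ʳ-injectiveʳ (zeros n-1) (zeros n-1) (trans e (sym (zeros-∷ʳ n-1))))

  α₀≢seg : ∀ {i k} → i ∈ Is → k < i → α₀ ≢ seg n i k
  α₀≢seg {suc zero} _ _ e = α₀≢zeros e
  α₀≢seg {suc (suc q)} {zero} i∈ _ e =
    zeros≢comb-∷ʳ (proj₂ (Is-bounds i∈)) (∷ʳ-injectiveˡ (zeros n-1) (comb (suc q) n-1 (suc q)) e)
  α₀≢seg {suc (suc q)} {suc k} i∈ _ e =
    true≢false (∷ʳ-injectiveʳ (zeros n-1) (comb (suc q) n-1 k) e)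

  α₀-good : Good α₀
  α₀-good = s₀ , α₀≢seg

  skip-flip : ∀ {i} → suc i ∈ Is → ∀ a u → u ++ [ PCR3 (a ∷ u) ] ≡ gamma n (suc i) →
              u ++ [ not (PCR3 (a ∷ u)) ] ≡ g (seg n (suc i) i)
  skip-flip {zero} i∈ a u e with PCR3 (a ∷ u) | ∷ʳ-injective u (zeros n-1) (trans e (sym (zeros-∷ʳ n-1)))
  ... | .false | refl , refl = sym (g-zeros s₀)
  skip-flip {suc q} i∈ a u e
    with PCR3 (a ∷ u) | ∷ʳ-injective u (comb (suc q) n-1 (suc q)) (trans e (gamma≡comb n q))
  ... | .true | refl , refl = sym (comb-next (proj₂ (Is-bounds i∈)) ≤-refl (seg-S i∈ (suc q) ≤-refl))

  -- R is tested before the correction by S. A corrected step onto γᵢ would escape the test, but it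
  -- needs the conjugate of γᵢ outside S; that conjugate is `α₀` for i = 1 and otherwise lighter
  -- than γᵢ.
  gamma-conj-S : ∀ {i} → i ∈ Is → ∀ u x → u ++ [ not x ] ≡ gamma n i → S (u ++ [ x ])
  gamma-conj-S {zero} i∈ u x e = ⊥-elim (<-irrefl refl (proj₁ (Is-bounds i∈)))
  gamma-conj-S {suc zero} i∈ u x e with ∷ʳ-injective u (zeros n-1) (trans e (sym (zeros-∷ʳ n-1)))
  gamma-conj-S {suc zero} i∈ u true e | refl , refl = s₀
  gamma-conj-S {suc (suc q)} i∈ u x e
    with ∷ʳ-injective u (comb (suc q) n-1 (suc q)) (trans e (gamma≡comb n q))
  gamma-conj-S {suc (suc q)} i∈ u false e | refl , refl = S-conj (subst S (sym e) (Is-S i∈))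

  data Step (x : Str) : Set where
    same : f x ≡ g x → (∀ {i} → i ∈ Is → g x ≢ gamma n i) → Step x
    jump : ∀ {i} → suc i ∈ Is → g x ≡ gamma n (suc i) → f x ≡ g (seg n (suc i) i) → Step x

  step-view : ∀ {x} → S x → Step x
  step-view {a ∷ u} (inside l _) with true-or-false (inR n s (u ++ [ PCR3 (a ∷ u) ]))
  ... | inj₁ eR with inR⁻ _ eR
  ...   | zero  , i∈ , e = ⊥-elim (<-irrefl refl (proj₁ (Is-bounds i∈)))
  ...   | suc i , i∈ , e = jump i∈ (trans (g-in a u refl sβ) e)
                             (trans (f-jump a u (S.member sβ) eR) (skip-flip i∈ a u e))
    where
    sβ : S (u ++ [ PCR3 (a ∷ u) ])
    sβ = subst S (sym e) (Is-S i∈)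
  step-view {a ∷ u} (inside l _) | inj₂ eR = same (f-same a u eR) not-gamma
    where
    x = PCR3 (a ∷ u)
    not-gamma : ∀ {i} → i ∈ Is → g (a ∷ u) ≢ gamma n i
    not-gamma {i} i∈ e with S? {u ++ [ x ]} (trans (length-∷ʳ u x) l)
    ... | inj₁ sβ = true≢false (trans (sym (inR⁺ i∈))
                      (trans (cong (inR n s) (trans (sym e) (g-in a u refl sβ))) eR))
    ... | inj₂ ¬s = true≢false (trans (sym (S.member (gamma-conj-S i∈ u x (trans (sym (g-out a u refl ¬s)) e)))) ¬s)

  -- If one segment followed directly on another, a jump over the first would land on a skipped
  -- string. For i = 1 the target is `α₀`; otherwise it ends in 0, like no γ but 0ⁿ, and contains a
  -- 1.
  last-not-first : ∀ {i i′} → suc i ∈ Is → i′ ∈ Is → g (seg n (suc i) i) ≢ gamma n i′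
  last-not-first {zero}  {i′} i∈ i′∈ e =
    α₀≢seg i′∈ (proj₁ (Is-bounds i′∈)) (trans (sym (g-zeros s₀)) (trans e (gamma≡seg n i′)))
  last-not-first {suc q} {zero} i∈ i′∈ e = <-irrefl refl (proj₁ (Is-bounds i′∈))
  last-not-first {suc q} {suc zero} i∈ i′∈ e =
    zeros≢comb-∷ʳ (proj₂ (Is-bounds i∈)) (∷ʳ-injectiveˡ (zeros n-1) (comb (suc q) n-1 (suc q))
      (trans (zeros-∷ʳ n-1) (trans (sym e) (comb-next (proj₂ (Is-bounds i∈)) ≤-refl (seg-S i∈ (suc q) ≤-refl)))))
  last-not-first {suc q} {suc (suc q′)} i∈ i′∈ e =
    true≢false (∷ʳ-injectiveʳ (comb (suc q′) n-1 (suc q′)) (comb (suc q) n-1 (suc q))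
      (trans (sym (gamma≡comb n q′)) (trans (sym e) (comb-next (proj₂ (Is-bounds i∈)) ≤-refl (seg-S i∈ (suc q) ≤-refl)))))

  -- Since `g` is injective on S, a segment can only be entered at its first string: whatever
  -- precedes a later member is itself a member.
  good-f : ∀ {x} → Good x → Good (f x)
  good-f {x} (sx , out) with step-view sx
  ... | same e ne = subst S (sym e) (g-S sx) , avoid
    where
    avoid : ∀ {i k} → i ∈ Is → k < i → f x ≢ seg n i k
    avoid {i} {zero}  i∈ k< e′ = ne i∈ (trans (sym e) (trans e′ (sym (gamma≡seg n i))))
    avoid {i} {suc k} i∈ k< e′ = out i∈ (<⇒≤ k<)
      (g-injective sx (seg-S i∈ k (<⇒≤ k<)) (trans (sym e) (trans e′ (sym (seg-next i∈ k k<)))))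
  ... | jump {j} j∈ _ e = subst S (sym e) (g-S last-S) , avoid
    where
    last-S : S (seg n (suc j) j)
    last-S = seg-S j∈ j ≤-refl
    avoid : ∀ {i k} → i ∈ Is → k < i → f x ≢ seg n i k
    avoid {i} {zero}  i∈ k< e′ = last-not-first j∈ i∈ (trans (sym e) (trans e′ (sym (gamma≡seg n i))))
    avoid {i} {suc k} i∈ k< e′
      with seg-injective j∈ i∈ ≤-refl (<⇒≤ k<)
             (g-injective last-S (seg-S i∈ k (<⇒≤ k<)) (trans (sym e) (trans e′ (sym (seg-next i∈ k k<)))))
    ... | refl , refl = <-irrefl refl k<

  good-iter : ∀ k {x} → Good x → Good (iter f k x)
  good-iter zero    gx = gx
  good-iter (suc k) gx = good-f (good-iter k gx)

  enter : ∀ {i x} → i ∈ Is → g x ≡ gamma n i → ∀ k → k < i → iter g (suc k) x ≡ seg n i k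
  enter {i} i∈ e zero    _  = trans e (gamma≡seg n i)
  enter {i} i∈ e (suc k) k< = trans (cong g (enter i∈ e k (<⇒≤ k<))) (seg-next i∈ k k<)

  -- A jump replaces i + 1 steps of `g` by one step of `f`, so the induction is on a bound `N` for
  -- `k`. The `g`-path cannot stop within the segment, because its endpoint is not skipped.
  shortcut : ∀ N k → k < N → ∀ {x} → Good x → Good (iter g (suc k) x) →
             ∃ λ l → iter f (suc l) x ≡ iter g (suc k) x
  shortcut (suc N) k k<N {x} gx gy with step-view (proj₁ gx)
  shortcut (suc N) zero    k<N {x} gx gy | same e _ = 0 , e
  shortcut (suc N) (suc k) k<N {x} gx gy | same e _
    with shortcut N k (≤-pred k<N) {f x} (good-f gx) (subst Good y≡ gy)
    where
    y≡ : iter g (suc (suc k)) x ≡ iter g (suc k) (f x)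
    y≡ = trans (iter-suc g (suc k) x) (cong (iter g (suc k)) (sym e))
  ... | l , e′ = suc l , trans (iter-suc f (suc l) x) (trans e′
                   (trans (cong (iter g (suc k)) e) (sym (iter-suc g (suc k) x))))
  shortcut (suc N) k k<N {x} gx gy | jump {j} j∈ eγ e with k <? suc j
  ... | yes k<i = ⊥-elim (proj₂ gy j∈ k<i (enter j∈ eγ k k<i))
  -- With i = `suc j`, of the `suc k` steps of `g` the jump accounts for `suc (suc j)`; if none
  -- remain, the target is reached.
  ... | no  k≮i = resume (k ∸ suc j) refl
    where
    fx≡ : f x ≡ iter g (suc (suc j)) x
    fx≡ = trans e (cong g (sym (enter j∈ eγ j ≤-refl)))
    k≡ : ∀ r → r ≡ k ∸ suc j → iter g (suc k) x ≡ iter g r (f x)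
    k≡ r r≡ = trans (cong (λ q → iter g q x)
                      (trans (cong suc (sym (m∸n+n≡m (≮⇒≥ k≮i))))
                        (trans (sym (+-suc (k ∸ suc j) (suc j))) (cong (_+ suc (suc j)) (sym r≡)))))
                (trans (iter-+ g r (suc (suc j)) x) (cong (iter g r) (sym fx≡)))
    resume : ∀ r → r ≡ k ∸ suc j → ∃ λ l → iter f (suc l) x ≡ iter g (suc k) x
    resume zero    r≡ = 0 , sym (k≡ 0 r≡)
    resume (suc r) r≡
      with shortcut N r (≤-trans (≤-trans (≤-reflexive r≡) (m∸n≤m k (suc j))) (≤-pred k<N))
             {f x} (good-f gx) (subst Good (k≡ (suc r) r≡) gy)
    ... | l , e′ = suc l , trans (iter-suc f (suc l) x) (trans e′ (sym (k≡ (suc r) r≡)))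

  good-reachable : ∀ {y} → Good y → ∃ λ l → iter f (suc l) α₀ ≡ y
  good-reachable gy with α₀-reaches s₀ (proj₁ gy)
  ... | k , refl = shortcut (suc k) k ≤-refl α₀-good gy

-- Counting strings

∈-allStrings⁺ : ∀ n {a} → length a ≡ n → a ∈ allStrings n
∈-allStrings⁺ zero    {[]}        _ = here refl
∈-allStrings⁺ (suc n) {false ∷ a} l = ∈-++⁺ˡ (∈-map⁺ (false ∷_) (∈-allStrings⁺ n (suc-injective l)))
∈-allStrings⁺ (suc n) {true ∷ a}  l = ∈-++⁺ʳ _ (∈-map⁺ (true ∷_) (∈-allStrings⁺ n (suc-injective l)))

∈-allStrings⁻ : ∀ n {a} → a ∈ allStrings n → length a ≡ n
∈-allStrings⁻ zero    (here refl) = refl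
∈-allStrings⁻ (suc n) a∈ with ∈-++⁻ (map (false ∷_) (allStrings n)) a∈
... | inj₁ a∈₀ with ∈-map⁻ (false ∷_) a∈₀
...   | b , b∈ , refl = cong suc (∈-allStrings⁻ n b∈)
∈-allStrings⁻ (suc n) a∈ | inj₂ a∈₁ with ∈-map⁻ (true ∷_) a∈₁
...   | b , b∈ , refl = cong suc (∈-allStrings⁻ n b∈)

allStrings-unique : ∀ n → Unique (allStrings n)
allStrings-unique zero    = [] ∷ []
allStrings-unique (suc n) = Uniq.++⁺ (Uniq.map⁺ ∷-injectiveʳ (allStrings-unique n))
                                     (Uniq.map⁺ ∷-injectiveʳ (allStrings-unique n)) disjoint
  where
  disjoint : ∀ {a} → ¬ (a ∈ map (false ∷_) (allStrings n) × a ∈ map (true ∷_) (allStrings n))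
  disjoint (a∈₀ , a∈₁) with ∈-map⁻ (false ∷_) a∈₀ | ∈-map⁻ (true ∷_) a∈₁
  ... | _ , _ , refl | _ , _ , ()

length-allStrings : ∀ n → length (allStrings n) ≡ 2 ^ n
length-allStrings zero    = refl
length-allStrings (suc n) = begin
  length (map (false ∷_) (allStrings n) ++ map (true ∷_) (allStrings n))
    ≡⟨ length-++ (map (false ∷_) (allStrings n)) ⟩
  length (map (false ∷_) (allStrings n)) + length (map (true ∷_) (allStrings n))
    ≡⟨ cong₂ _+_ (trans (length-map _ (allStrings n)) (length-allStrings n))
                 (trans (length-map _ (allStrings n)) (length-allStrings n)) ⟩
  2 ^ n + 2 ^ n ≡⟨ cong (2 ^ n +_) (sym (+-identityʳ (2 ^ n))) ⟩
  2 ^ suc n ∎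
  where open ≡-Reasoning

module _ {X : Set} (p : X → Bool) where

  select : List X → List X
  select = filter (λ x → p x BoolP.≟ true)

  countB≡length : ∀ xs → countB p xs ≡ length (select xs)
  countB≡length []       = refl
  countB≡length (x ∷ xs) with p x
  ... | true  = cong suc (countB≡length xs)
  ... | false = countB≡length xs

  ∈-select⁺ : ∀ xs {x} → x ∈ xs → p x ≡ true → x ∈ select xs
  ∈-select⁺ _ = ∈-filter⁺ (λ x → p x BoolP.≟ true)

  ∈-select⁻ : ∀ xs {x} → x ∈ select xs → x ∈ xs × p x ≡ true
  ∈-select⁻ xs = ∈-filter⁻ (λ x → p x BoolP.≟ true) {xs = xs}

  select-unique : ∀ {xs} → Unique xs → Unique (select xs)
  select-unique = Uniq.filter⁺ (λ x → p x BoolP.≟ true)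

module _ {X Y : Set} (f : X → List Y) where

  concatMap⁻ : ∀ {y} xs → y ∈ concatMap f xs → ∃ λ x → x ∈ xs × y ∈ f x
  concatMap⁻ xs y∈ = find (∈-concatMap⁻ f {xs} y∈)

  concatMap⁺ : ∀ {x y xs} → x ∈ xs → y ∈ f x → y ∈ concatMap f xs
  concatMap⁺ {xs = xs} x∈ y∈ = ∈-concatMap⁺ f {xs} (lose x∈ y∈)

  concatMap-unique : ∀ {xs} → Unique xs → (∀ {x} → x ∈ xs → Unique (f x)) →
    (∀ {x x′ y} → x ∈ xs → x′ ∈ xs → y ∈ f x → y ∈ f x′ → x ≡ x′) → Unique (concatMap f xs)
  concatMap-unique {[]}     _          _ _ = []
  concatMap-unique {x ∷ xs} (x∉ ∷ uxs) u d = Uniq.++⁺ (u (here refl))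
    (concatMap-unique uxs (u ∘ there) (λ x∈ x′∈ → d (there x∈) (there x′∈))) disjoint
    where
    disjoint : ∀ {y} → ¬ (y ∈ f x × y ∈ concatMap f xs)
    disjoint (y∈ , y∈′) with concatMap⁻ xs y∈′
    ... | x′ , x′∈ , y∈″ = All.lookup x∉ x′∈ (d (here refl) (there x′∈) y∈ y∈″)

  length-concatMap : ∀ (c : X → ℕ) {xs} → (∀ {x} → x ∈ xs → length (f x) ≡ c x) →
                     length (concatMap f xs) ≡ sum (map c xs)
  length-concatMap c {[]}     _ = refl
  length-concatMap c {x ∷ xs} l = trans (length-++ (f x)) (cong₂ _+_ (l (here refl)) (length-concatMap c (l ∘ there)))

sum-const : ∀ {X : Set} h (xs : List X) → sum (map (λ _ → h) xs) ≡ h * length xs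
sum-const h []       = sym (*-zeroʳ h)
sum-const h (x ∷ xs) = trans (cong (h +_) (sum-const h xs)) (sym (*-suc h (length xs)))

weight-complement : ∀ a → weight a + weight (map not a) ≡ length a
weight-complement []          = refl
weight-complement (true ∷ a)  = cong suc (weight-complement a)
weight-complement (false ∷ a) = trans (+-suc (weight a) _) (cong suc (weight-complement a))

complement-injective : ∀ {a b} → map not a ≡ map not b → a ≡ b
complement-injective = map-injective BoolP.not-injective

-- Complementation maps the strings of weight at most m injectively to
-- heavier ones.
A-half : ∀ n m → m + m < n → A n m + A n m ≤ 2 ^ n
A-half n m m+m<n = begin
  A n m + A n m                        ≡⟨ cong₂ _+_ (countB≡length p (allStrings n)) (trans (countB≡length p (allStrings n)) (sym (length-map (map not) Y))) ⟩
  length Y + length (map (map not) Y)  ≡⟨ sym (length-++ Y) ⟩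
  length (Y ++ map (map not) Y)        ≤⟨ unique-⊆-length (Uniq.++⁺ uY (Uniq.map⁺ complement-injective uY) disjoint) sub ⟩
  length (allStrings n)                ≡⟨ length-allStrings n ⟩
  2 ^ n                                ∎
  where
  open ≤-Reasoning
  p : Str → Bool
  p a = weight a ≤ᵇ m
  Y = select p (allStrings n)
  uY : Unique Y
  uY = select-unique p (allStrings-unique n)
  disjoint : ∀ {a} → ¬ (a ∈ Y × a ∈ map (map not) Y)
  disjoint (a∈ , a∈′) with ∈-map⁻ (map not) a∈′
  ... | b , b∈ , refl with ∈-select⁻ p (allStrings n) a∈ | ∈-select⁻ p (allStrings n) b∈
  ...   | _ , e | b∈words , e′ = <⇒≱ m+m<n (subst (_≤ m + m) (trans (weight-complement b) (∈-allStrings⁻ n b∈words))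
                                  (+-mono-≤ (≤ᵇ-true⁻ {weight b} e′) (≤ᵇ-true⁻ {weight (map not b)} e)))
  sub : ∀ {a} → a ∈ Y ++ map (map not) Y → a ∈ allStrings n
  sub a∈ with ∈-++⁻ Y a∈
  ... | inj₁ a∈Y = proj₁ (∈-select⁻ p (allStrings n) a∈Y)
  ... | inj₂ a∈′ with ∈-map⁻ (map not) a∈′
  ...   | b , b∈ , refl = ∈-allStrings⁺ n (trans (length-map not b) (∈-allStrings⁻ n (proj₁ (∈-select⁻ p (allStrings n) b∈))))

module CountS (n-1 m-1 h-1 : ℕ) (reps : List Str) (unique-reps : Unique reps)
  (reps-ok : ∀ {r} → r ∈ reps → length r ≡ suc n-1 × weight r ≡ suc m-1 × period r ≡ suc h-1 × necklace r ≡ true)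
  where

  private
    m = suc m-1
    h = suc h-1

  open Joined n-1 m h reps (λ r∈ → proj₁ (proj₂ (reps-ok r∈)))

  private
    lighter shorter : Str → Bool
    lighter a = weight a ≤ᵇ m-1
    shorter a = (weight a ≡ᵇ m) ∧ (period a ≤ᵇ h-1)

    cycle : Str → List Str
    cycle r = applyUpTo (λ k → iter rot k r) h

    words = allStrings n

    nonempty : ∀ (b : Str) → length b ≡ n → 0 < length b
    nonempty _ l = subst (0 <_) (sym l) z<s

  -- The three parts mirror the terms from which s is computed: the two predicates are those counted
  -- by `A` and `C` at the predecessors of `m` and `h`, and each representative contributes `h`
  -- rotations.
  strings : List Str
  strings = select lighter words ++ (select shorter words ++ concatMap cycle reps)

  private
    ∈-cycles⁻ : ∀ {b} → b ∈ concatMap cycle reps → ∃₂ λ r k → r ∈ reps × iter rot k r ≡ b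
    ∈-cycles⁻ b∈ with concatMap⁻ cycle reps b∈
    ... | r , r∈ , b∈′ with ∈-applyUpTo⁻ (λ k → iter rot k r) b∈′
    ...   | k , _ , e = r , k , r∈ , sym e

    cycles-length : ∀ {b} → b ∈ concatMap cycle reps → length b ≡ n
    cycles-length b∈ with ∈-cycles⁻ b∈
    ... | r , k , r∈ , refl = trans (length-rots k r) (proj₁ (reps-ok r∈))

    cycles-weight : ∀ {b} → b ∈ concatMap cycle reps → weight b ≡ m
    cycles-weight b∈ with ∈-cycles⁻ b∈
    ... | r , k , r∈ , refl = trans (weight-rots k r) (proj₁ (proj₂ (reps-ok r∈)))

    cycles-period : ∀ {b} → b ∈ concatMap cycle reps → period b ≡ h
    cycles-period b∈ with ∈-cycles⁻ b∈
    ... | r , k , r∈ , refl = trans (period-rots k r (nonempty r (proj₁ (reps-ok r∈)))) (proj₁ (proj₂ (proj₂ (reps-ok r∈))))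

    cycle-unique : ∀ {r} → r ∈ reps → Unique (cycle r)
    cycle-unique {r} r∈ with reps-ok r∈
    ... | l , _ , pr , _ = Uniq.applyUpTo⁺₁ _ h λ i<j j<h → rots-distinct r (nonempty r l) i<j (subst (_ <_) (sym pr) j<h)

    -- A cycle contains only one necklace, and the representatives are necklaces.
    cycle-disjoint : ∀ {r r′ b} → r ∈ reps → r′ ∈ reps → b ∈ cycle r → b ∈ cycle r′ → r ≡ r′
    cycle-disjoint {r} {r′} r∈ r′∈ b∈ b∈′
      with ∈-applyUpTo⁻ (λ k → iter rot k r) b∈ | ∈-applyUpTo⁻ (λ k → iter rot k r′) b∈′
    ... | k , _ , refl | k′ , _ , e with unrot k′ r′
    ...   | l , e′ = necklace-unique r r′ (proj₂ (proj₂ (proj₂ (reps-ok r∈)))) (proj₂ (proj₂ (proj₂ (reps-ok r′∈))))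
                       (l + k) (trans (iter-+ rot l k r) (trans (cong (iter rot l) e) e′))

  strings-unique : Unique strings
  strings-unique = Uniq.++⁺ (select-unique lighter (allStrings-unique n))
    (Uniq.++⁺ (select-unique shorter (allStrings-unique n))
              (concatMap-unique cycle unique-reps cycle-unique cycle-disjoint) disjoint₂) disjoint₁
    where
    disjoint₂ : ∀ {b} → ¬ (b ∈ select shorter words × b ∈ concatMap cycle reps)
    disjoint₂ {b} (b∈ , b∈′) with ∧-true⁻ {weight b ≡ᵇ m} (proj₂ (∈-select⁻ shorter words b∈))
    ... | _ , e = <-irrefl (cycles-period b∈′) (s≤s (≤ᵇ-true⁻ e))
    disjoint₁ : ∀ {b} → ¬ (b ∈ select lighter words × b ∈ select shorter words ++ concatMap cycle reps)
    disjoint₁ {b} (b∈ , b∈′) with ≤ᵇ-true⁻ (proj₂ (∈-select⁻ lighter words b∈)) | ∈-++⁻ (select shorter words) b∈′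
    ... | w≤ | inj₁ b∈₁ = <-irrefl (≡ᵇ-true⁻ (proj₁ (∧-true⁻ {weight b ≡ᵇ m} (proj₂ (∈-select⁻ shorter words b∈₁))))) (s≤s w≤)
    ... | w≤ | inj₂ b∈₂ = <-irrefl (cycles-weight b∈₂) (s≤s w≤)

  ∈-strings⁻ : ∀ {b} → b ∈ strings → S b
  ∈-strings⁻ {b} b∈ with ∈-++⁻ (select lighter words) b∈
  ... | inj₁ b∈₀ with ∈-select⁻ lighter words b∈₀
  ...   | b∈words , e = S⁺ (∈-allStrings⁻ n b∈words) (light (s≤s (≤ᵇ-true⁻ e)))
  ∈-strings⁻ {b} b∈ | inj₂ b∈′ with ∈-++⁻ (select shorter words) b∈′
  ... | inj₁ b∈₁ with ∈-select⁻ shorter words b∈₁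
  ...   | b∈words , e with ∧-true⁻ {weight b ≡ᵇ m} e
  ...     | e₁ , e₂ = S⁺ (∈-allStrings⁻ n b∈words) (short (≡ᵇ-true⁻ e₁) (s≤s (≤ᵇ-true⁻ e₂)))
  ∈-strings⁻ {b} b∈ | inj₂ b∈′ | inj₂ b∈₂ with ∈-cycles⁻ b∈₂
  ... | r , k , r∈ , e with unrot k r
  ...   | l , e′ = S⁺ (cycles-length b∈₂) (chosen r∈ l (trans (cong (iter rot l) (sym e)) e′))

  ∈-strings⁺ : ∀ {b} → S b → b ∈ strings
  ∈-strings⁺ {b} sb@(inside l _) with S⁻ sb
  ... | light lt  = ∈-++⁺ˡ (∈-select⁺ lighter words (∈-allStrings⁺ n l) (≤ᵇ-true (≤-pred lt)))
  ... | short w p = ∈-++⁺ʳ (select lighter words) (∈-++⁺ˡ (∈-select⁺ shorter words (∈-allStrings⁺ n l)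
                      (cong₂ _∧_ (≡ᵇ-true w) (≤ᵇ-true (≤-pred p)))))
  ... | chosen {r} r∈ k e with unrot k b
  ...   | j , e′ with rots-<-period r (nonempty r (proj₁ (reps-ok r∈))) j
  ...     | i , i< , e″ = ∈-++⁺ʳ (select lighter words) (∈-++⁺ʳ (select shorter words) (concatMap⁺ cycle r∈
              (subst (_∈ cycle r) (trans e″ (trans (cong (iter rot j) (sym e)) e′))
                (∈-applyUpTo⁺ (λ k → iter rot k r) (subst (i <_) (proj₁ (proj₂ (proj₂ (reps-ok r∈)))) i<)))))

  length-strings : length strings ≡ A n m-1 + C n m h-1 + h * length reps
  length-strings = begin
    length strings
      ≡⟨ length-++ (select lighter words) ⟩
    length (select lighter words) + length (select shorter words ++ concatMap cycle reps)
      ≡⟨ cong (length (select lighter words) +_) (length-++ (select shorter words)) ⟩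
    length (select lighter words) + (length (select shorter words) + length (concatMap cycle reps))
      ≡⟨ sym (+-assoc (length (select lighter words)) _ _) ⟩
    length (select lighter words) + length (select shorter words) + length (concatMap cycle reps)
      ≡⟨ cong₂ _+_ (cong₂ _+_ (sym (countB≡length lighter words)) (sym (countB≡length shorter words)))
           (trans (length-concatMap cycle (λ _ → h) {reps} (λ {r} _ → length-applyUpTo (λ k → iter rot k r) h)) (sum-const h reps)) ⟩
    A n m-1 + C n m h-1 + h * length reps ∎
    where open ≡-Reasoning

-- Reading the sequence off the states

applyUpTo-cong : ∀ {X : Set} {F G : ℕ → X} → (∀ q → F q ≡ G q) → ∀ k → applyUpTo F k ≡ applyUpTo G k
applyUpTo-cong e zero    = refl
applyUpTo-cong e (suc k) = cong₂ _∷_ (e 0) (applyUpTo-cong (e ∘ suc) k)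

applyUpTo-+ : ∀ {X : Set} (G : ℕ → X) a b → applyUpTo G (a + b) ≡ applyUpTo G a ++ applyUpTo (λ q → G (a + q)) b
applyUpTo-+ G zero    b = refl
applyUpTo-+ G (suc a) b = cong (G 0 ∷_) (applyUpTo-+ (G ∘ suc) a b)

take-applyUpTo : ∀ {X : Set} (G : ℕ → X) a b → take a (applyUpTo G (a + b)) ≡ applyUpTo G a
take-applyUpTo G zero    b = refl
take-applyUpTo G (suc a) b = cong (G 0 ∷_) (take-applyUpTo (G ∘ suc) a b)

drop-applyUpTo : ∀ {X : Set} (G : ℕ → X) a b → drop a (applyUpTo G (a + b)) ≡ applyUpTo (λ q → G (a + q)) b
drop-applyUpTo G zero    b = refl
drop-applyUpTo G (suc a) b = drop-applyUpTo (G ∘ suc) a b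

concat-periodic : ∀ {X : Set} (G : ℕ → X) L → (∀ q → G (L + q) ≡ G q) →
                  ∀ k → concat (replicate k (applyUpTo G L)) ≡ applyUpTo G (k * L)
concat-periodic G L per zero    = refl
concat-periodic G L per (suc k) = trans
  (cong (applyUpTo G L ++_) (trans (concat-periodic G L per k) (sym (applyUpTo-cong per (k * L)))))
  (sym (applyUpTo-+ G L (k * L)))

cycWindow-periodic : ∀ (G : ℕ → Bool) L → (∀ q → G (L + q) ≡ G q) → ∀ n i → i < L →
                     cycWindow (applyUpTo G L) n i ≡ applyUpTo (λ q → G (i + q)) n
cycWindow-periodic G L per n i i<L = begin
  take n (drop i (concat (replicate (suc (suc n)) (applyUpTo G L)))) ≡⟨ cong (take n ∘ drop i) (concat-periodic G L per (suc (suc n))) ⟩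
  take n (drop i (applyUpTo G M))                         ≡⟨ cong (λ l → take n (drop i (applyUpTo G l))) (sym (m+[n∸m]≡n i≤M)) ⟩
  take n (drop i (applyUpTo G (i + (M ∸ i))))             ≡⟨ cong (take n) (drop-applyUpTo G i (M ∸ i)) ⟩
  take n (applyUpTo (λ q → G (i + q)) (M ∸ i))            ≡⟨ cong (λ l → take n (applyUpTo (λ q → G (i + q)) l)) (sym (m+[n∸m]≡n n≤M)) ⟩
  take n (applyUpTo (λ q → G (i + q)) (n + (M ∸ i ∸ n)))  ≡⟨ take-applyUpTo (λ q → G (i + q)) n _ ⟩
  applyUpTo (λ q → G (i + q)) n                           ∎
  where
  open ≡-Reasoning
  M = suc (suc n) * L
  i≤M : i ≤ M
  i≤M = ≤-trans (<⇒≤ i<L) (m≤m+n L (suc n * L))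
  -- One of the `n + 2` copies covers the offset `i < L`; the others have total length above `n`, as
  -- `L` is positive.
  n≤M : n ≤ M ∸ i
  n≤M = m+n≤o⇒m≤o∸n n (≤-trans (≤-reflexive (+-comm n i)) (+-mono-≤ (<⇒≤ i<L)
          (≤-trans (n≤1+n n) (≤-trans (≤-reflexive (sym (*-identityʳ (suc n)))) (*-monoʳ-≤ (suc n) (≤-trans z<s i<L))))))

module ShiftRegister (f : Str → Str) (shift : ∀ a u → ∃ λ x → f (a ∷ u) ≡ u ++ [ x ]) where

  -- The contents of the register come out in order, whatever is fed in behind them; `w` collects
  -- the symbols fed in.
  first-symbols : ∀ v w → applyUpTo (λ q → firstSym (iter f q (v ++ w))) (length v) ≡ v
  first-symbols []      w = refl
  first-symbols (a ∷ v) w with shift a (v ++ w)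
  ... | x , e = cong (a ∷_) (trans
      (applyUpTo-cong (λ q → cong firstSym (trans (iter-suc f q _)
        (cong (iter f q) (trans e (++-assoc v w [ x ]))))) (length v))
      (first-symbols v (w ++ [ x ])))

  cycWindow-state : ∀ {z n L} → (∀ k → length (iter f k z) ≡ n) → iter f L z ≡ z → ∀ i → i < L →
                    cycWindow (map (λ k → firstSym (iter f k z)) (upTo L)) n i ≡ iter f i z
  cycWindow-state {z} {n} {L} len ret i i<L = begin
    cycWindow (map G (upTo L)) n i                         ≡⟨ cong (λ c → cycWindow c n i) (map-upTo G L) ⟩
    cycWindow (applyUpTo G L) n i                          ≡⟨ cycWindow-periodic G L per n i i<L ⟩
    applyUpTo (λ q → G (i + q)) n                          ≡⟨ applyUpTo-cong (λ q → cong firstSym (from-i q)) n ⟩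
    applyUpTo (λ q → firstSym (iter f q (x ++ []))) n      ≡⟨ cong (applyUpTo (λ q → firstSym (iter f q (x ++ [])))) (sym (len i)) ⟩
    applyUpTo (λ q → firstSym (iter f q (x ++ []))) (length x) ≡⟨ first-symbols x [] ⟩
    x                                                      ∎
    where
    open ≡-Reasoning
    G = λ k → firstSym (iter f k z)
    x = iter f i z
    per : ∀ q → G (L + q) ≡ G q
    per q = cong firstSym (trans (cong (λ l → iter f l z) (+-comm L q))
              (trans (iter-+ f q L z) (cong (iter f q) ret)))
    from-i : ∀ q → iter f (i + q) z ≡ iter f q (x ++ [])
    from-i q = trans (cong (λ l → iter f l z) (+-comm i q))
                 (trans (iter-+ f q i z) (cong (iter f q) (sym (++-identityʳ x))))

-- The set R

indices : ℕ → ℕ → List ℕ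
indices n zero      = []
indices n s@(suc _) = if s ≤ᵇ ⌈ n /2⌉ then [ s ] else ⌈ n /2⌉ ∷ [ s ∸ ⌈ n /2⌉ ]

inR⁻ : ∀ n s b → inR n s b ≡ true → ∃ λ i → i ∈ indices n s × b ≡ gamma n i
inR⁻ n (suc s) b e with suc s ≤ᵇ ⌈ n /2⌉
... | true  = suc s , here refl , ==⇒≡ e
... | false with ∨-true⁻ {b == gamma n ⌈ n /2⌉} e
...   | inj₁ e′ = ⌈ n /2⌉ , here refl , ==⇒≡ e′
...   | inj₂ e′ = suc s ∸ ⌈ n /2⌉ , there (here refl) , ==⇒≡ e′

inR⁺ : ∀ n s {i} → i ∈ indices n s → inR n s (gamma n i) ≡ true
inR⁺ n (suc s) i∈ with suc s ≤ᵇ ⌈ n /2⌉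
inR⁺ n (suc s) (here refl)         | true  = ≡⇒== {gamma n (suc s)} refl
inR⁺ n (suc s) (here refl)         | false = ∨-trueˡ (≡⇒== {gamma n ⌈ n /2⌉} refl)
inR⁺ n (suc s) (there (here refl)) | false =
  ∨-trueʳ {gamma n (suc s ∸ ⌈ n /2⌉) == gamma n ⌈ n /2⌉} (≡⇒== {gamma n (suc s ∸ ⌈ n /2⌉)} refl)

≰ᵇ⇒> : ∀ {a b} → (a ≤ᵇ b) ≡ false → b < a
≰ᵇ⇒> e = ≰⇒> λ le → true≢false (trans (sym (≤ᵇ-true le)) e)

-- `⌈ n /2⌉` is by definition `⌊ suc n /2⌋`, the smaller half of `suc n`.
half-double : ∀ n → ⌈ n /2⌉ + ⌈ n /2⌉ ≤ suc n
half-double n = ≤-trans (+-monoʳ-≤ ⌈ n /2⌉ (⌊n/2⌋≤⌈n/2⌉ (suc n))) (≤-reflexive (⌊n/2⌋+⌈n/2⌉≡n (suc n)))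

-- Subtracting ⌈n/2⌉ from s < n leaves less than ⌊n/2⌋. The strict bound also makes the two indices
-- in R distinct.
remainder<half : ∀ n s → s < n → ⌈ n /2⌉ < s → s ∸ ⌈ n /2⌉ < ⌈ n /2⌉
remainder<half n s s<n j<s = <-≤-trans
  (subst (s ∸ ⌈ n /2⌉ <_) (trans (cong (_∸ ⌈ n /2⌉) (sym (⌊n/2⌋+⌈n/2⌉≡n n))) (m+n∸n≡m ⌊ n /2⌋ ⌈ n /2⌉))
    (∸-monoˡ-< s<n (<⇒≤ j<s)))
  (⌊n/2⌋≤⌈n/2⌉ n)

indices-bounds : ∀ n s → s < n → ∀ {i} → i ∈ indices n s → 0 < i × i + i ≤ suc n × i ≤ s
indices-bounds n@(suc _) (suc s) s<n i∈ with suc s ≤ᵇ ⌈ n /2⌉ in eq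
indices-bounds n@(suc _) (suc s) s<n (here refl) | true =
  z<s , ≤-trans (+-mono-≤ s≤j s≤j) (half-double n) , ≤-refl
  where
  s≤j : suc s ≤ ⌈ n /2⌉
  s≤j = ≤ᵇ-true⁻ {suc s} eq
indices-bounds n@(suc _) (suc s) s<n (here refl) | false =
  z<s , half-double n , <⇒≤ (≰ᵇ⇒> {suc s} eq)
indices-bounds n@(suc _) (suc s) s<n (there (here refl)) | false =
  m<n⇒0<n∸m j<s , ≤-trans (+-mono-≤ r≤j r≤j) (half-double n) , m∸n≤m (suc s) ⌈ n /2⌉
  where
  j<s : ⌈ n /2⌉ < suc s
  j<s = ≰ᵇ⇒> {suc s} eq
  r≤j : suc s ∸ ⌈ n /2⌉ ≤ ⌈ n /2⌉
  r≤j = <⇒≤ (remainder<half n (suc s) s<n j<s)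

indices-unique : ∀ n s → s < n → Unique (indices n s)
indices-unique n zero    s<n = []
indices-unique n (suc s) s<n with suc s ≤ᵇ ⌈ n /2⌉ in eq
... | true  = [] ∷ []
... | false = ((λ e → <-irrefl (sym e) (remainder<half n (suc s) s<n (≰ᵇ⇒> {suc s} eq))) ∷ []) ∷ ([] ∷ [])

indices-sum : ∀ n s → sum (map id (indices n s)) ≡ s
indices-sum n zero    = refl
indices-sum n (suc s) with suc s ≤ᵇ ⌈ n /2⌉ in eq
... | true  = +-identityʳ (suc s)
... | false = trans (cong (⌈ n /2⌉ +_) (+-identityʳ (suc s ∸ ⌈ n /2⌉))) (m+[n∸m]≡n (<⇒≤ (≰ᵇ⇒> {suc s} {⌈ n /2⌉} eq)))

-- Membership of the γᵢ in S

weight-blocks : ∀ p x → weight (blocks p x) ≡ x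
weight-blocks p zero    = refl
weight-blocks p (suc x) = trans (weight-++ (blk (suc p)) (blocks p x))
  (cong₂ _+_ (weight-zeros-++ p [ true ]) (weight-blocks p x))

half-< : ∀ {a m} → suc (a + a) ≤ m + m → a < m
half-< {a} {m} le = ≰⇒> λ m≤a → <⇒≱ le (+-mono-≤ m≤a m≤a)

half-≤ : ∀ {a m} → a + a ≤ suc (m + m) → a ≤ m
half-≤ {a} {m} le = ≮⇒≥ λ m<a → <⇒≱ (≤-trans (≤-reflexive (cong suc (sym (+-suc m m)))) (+-mono-≤ m<a m<a)) le

-- n is the length and 1 + x the weight of γᵢ, i = p + 1.
comb-light : ∀ p n c x → 2 ≤ p → c ≤ p → suc (p + p) ≤ n → n ≡ x * suc p + suc c → suc (suc x + suc x) ≤ n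
comb-light p n c zero 2≤p c≤p big n≡ =
  ⊥-elim (<⇒≱ (≤-trans (s≤s (+-monoˡ-≤ p (<⇒≤ 2≤p))) big) (≤-trans (≤-reflexive n≡) (s≤s c≤p)))
comb-light p n c (suc zero) 2≤p c≤p big n≡ = ≤-trans (s≤s (+-mono-≤ 2≤p 2≤p)) big
-- Blocks have length at least 3, so y blocks give n ≥ 3y + 1, which is at least 2(y + 1) + 1 once y
-- ≥ 2. Fewer blocks are settled by `suc (p + p) ≤ n`.
comb-light p n c (suc (suc x)) 2≤p c≤p big n≡ = begin
  suc (3 + x + (3 + x))          ≤⟨ m≤m+n _ x ⟩
  suc (3 + x + (3 + x)) + x      ≡⟨ solve 1 (λ x → con 1 :+ (con 3 :+ x :+ (con 3 :+ x)) :+ x := (con 2 :+ x) :* con 3 :+ con 1) refl x ⟩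
  suc (suc x) * 3 + 1            ≤⟨ +-mono-≤ (*-monoʳ-≤ (suc (suc x)) (s≤s 2≤p)) (s≤s z≤n) ⟩
  suc (suc x) * suc p + suc c    ≡⟨ sym n≡ ⟩
  n                              ∎
  where
  open ≤-Reasoning
  open +-*-Solver

module GammaS (n-1 m-1 h : ℕ) (reps : List Str) (reps-weight : ∀ {r} → r ∈ reps → weight r ≡ suc m-1)
  (s₀ : Joined.S n-1 (suc m-1) h reps reps-weight (zeros n-1 ++ [ true ]))
  (n≤2m : suc n-1 ≤ suc m-1 + suc m-1)
  (alt : suc n-1 ≡ 2 * suc m-1 ∸ 1 → inT reps (altStr (suc m-1)) ≡ true) where

  open Joined n-1 (suc m-1) h reps reps-weight

  private
    m = suc m-1

    form-weight : ∀ {p} (F : CombForm p n 0) → weight (comb p n 0) ≡ suc (CombForm.x F)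
    form-weight {p} (combForm c x _ _ shape) = trans (cong weight shape) (trans (weight-zeros-++ c _)
      (cong suc (trans (weight-++ (blocks p x) []) (trans (+-identityʳ _) (weight-blocks p x)))))

    double : ∀ x → x * 2 ≡ x + x
    double x = trans (*-comm x 2) (cong (x +_) (+-identityʳ x))

  -- The weight of γᵢ is ⌈n/i⌉, to be compared with n/2 ≤ m. The condition `i < h` stems from i ≤ s
  -- < h and serves the case i = 2 with n = 2m.
  gamma-S : ∀ i → 0 < i → i + i ≤ suc n → i < h → S (gamma n i)
  gamma-S (suc zero) _ _ _ = zeros-S s₀
  gamma-S (suc (suc (suc q))) _ 2i≤ _ with comb-form (2 + q) n 0 z<s
  ... | F@(combForm c x c≤p n≡ shape) = subst S (sym (gamma≡comb n (suc q)))
    (S⁺ (length-comb (2 + q) n 0) (light (subst (_< m) (sym (form-weight F))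
      (half-< (≤-trans (comb-light (2 + q) n c x (s≤s (s≤s z≤n)) c≤p
        (subst (_≤ n) (+-suc (2 + q) (2 + q)) (≤-pred 2i≤)) n≡) n≤2m)))))
  gamma-S (suc (suc zero)) _ _ 2<h with comb-form 1 n 0 z<s
  ... | F@(combForm c x c≤p n≡ shape) = subst S (sym (gamma≡comb n 0)) (balanced c c≤p n≡ shape)
    where
    w≡ : weight (comb 1 n 0) ≡ suc x
    w≡ = form-weight F
    balanced : ∀ c → c ≤ 1 → n ≡ x * 2 + suc c → comb 1 n 0 ≡ zeros c ++ true ∷ (blocks 1 x ++ []) → S (comb 1 n 0)
    balanced zero c≤p n≡ shape with m≤n⇒m<n∨m≡n (half-< {x} (≤-trans (≤-reflexive (sym n≡′)) n≤2m))
      where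
      n≡′ : n ≡ suc (x + x)
      n≡′ = trans n≡ (trans (+-comm (x * 2) 1) (cong suc (double x)))
    ... | inj₁ x<m = S⁺ (length-comb 1 n 0) (light (subst (_< m) (sym w≡) x<m))
    ... | inj₂ refl with inT⁻ (altStr m) (alt (trans n≡ (trans (+-comm (x * 2) 1) (trans (cong suc (double x))
                        (sym (trans (cong (x +_) (+-identityʳ (suc x))) (+-suc x x)))))))
    -- Here γ₂ is 1(01)ᵐ⁻¹, and a single rotation turns it into `altStr m`; hence the shift `k + 1`.
    ...   | r , r∈ , k , e = S⁺ (length-comb 1 n 0) (chosen r∈ (k + 1) (trans (iter-+ rot k 1 _)
              (trans (cong (iter rot k) (trans (cong rot shape) (cong (_++ [ true ]) (++-identityʳ (blocks 1 x))))) e)))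
    balanced (suc zero) c≤p n≡ shape with m≤n⇒m<n∨m≡n (half-≤ {suc x} {m} (≤-trans (≤-trans (≤-reflexive (sym n≡′)) n≤2m) (n≤1+n _)))
      where
      n≡′ : n ≡ suc x + suc x
      n≡′ = trans n≡ (trans (cong (_+ 2) (double x)) (trans (+-comm (x + x) 2) (cong suc (sym (+-suc x x)))))
    ... | inj₁ x<m = S⁺ (length-comb 1 n 0) (light (subst (_< m) (sym w≡) x<m))
    ... | inj₂ x≡m = S⁺ (length-comb 1 n 0) (short (trans w≡ x≡m)
                       (≤-<-trans (period-least (comb 1 n 0) pos (repeats z<s 2∣n fix)) 2<h))
      where
      pos : 0 < length (comb 1 n 0)
      pos = subst (0 <_) (sym (length-comb 1 n 0)) z<s
      shape′ : comb 1 n 0 ≡ blocks 1 (suc x)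
      shape′ = trans shape (cong (λ v → false ∷ true ∷ v) (++-identityʳ (blocks 1 x)))
      2∣n : 2 ∣ length (comb 1 n 0)
      2∣n = divides (suc x) (trans (cong length shape′) (length-pow (suc x) (blk 2)))
      fix : iter rot 2 (comb 1 n 0) ≡ comb 1 n 0
      fix = trans (cong (iter rot 2) shape′) (trans (rots-pow x (blk 2)) (sym shape′))
    balanced (suc (suc c)) (s≤s ()) _ _

-- The cycle of length L

module CutDown (n-1 m-1 h-1 L : ℕ) (reps : List Str)
  (reps-ok : ∀ {r} → r ∈ reps → length r ≡ suc n-1 × weight r ≡ suc m-1 × period r ≡ suc h-1 × necklace r ≡ true)
  (unique-reps : Unique reps) (alt : suc n-1 ≡ 2 * suc m-1 ∸ 1 → inT reps (altStr (suc m-1)) ≡ true)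
  (n≤2m : suc n-1 ≤ suc m-1 + suc m-1) {r₀ : Str} (r₀∈ : r₀ ∈ reps)
  (L≤total : L ≤ A (suc n-1) m-1 + C (suc n-1) (suc m-1) h-1 + suc h-1 * length reps)
  (total<L+h : A (suc n-1) m-1 + C (suc n-1) (suc m-1) h-1 + suc h-1 * length reps < L + suc h-1) where

  private
    m = suc m-1
    h = suc h-1
    total = A (suc n-1) m-1 + C (suc n-1) m h-1 + h * length reps
    s = total ∸ L

    reps-weight : ∀ {r} → r ∈ reps → weight r ≡ m
    reps-weight r∈ = proj₁ (proj₂ (reps-ok r∈))

  open Joined n-1 m h reps reps-weight
  open CountS n-1 m-1 h-1 reps unique-reps reps-ok

  private
    s<h : s < h
    s<h = m<n+o⇒m∸n<o total L total<L+h

    h≤n : h ≤ n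
    h≤n with reps-ok r₀∈
    ... | l , _ , p , _ = subst₂ _≤_ p l (period≤length r₀ (subst (0 <_) (sym l) z<s))

    s<n : s < n
    s<n = <-≤-trans s<h h≤n

    α₀-weight : weight α₀ ≡ 1
    α₀-weight = weight-zeros-++ n-1 [ true ]

    α₀-length : length α₀ ≡ n
    α₀-length = trans (length-∷ʳ (zeros n-1) true) (cong suc (length-replicate n-1))

    -- For `m = 1` the string belongs to S through T: a representative is a necklace of weight 1, so
    -- it ends in its only 1 and equals `α₀`.
    s₀ : S α₀
    s₀ with m≤n⇒m<n∨m≡n (s≤s (z≤n {m-1}))
    ... | inj₁ 1<m = S⁺ α₀-length (light (subst (_< m) (sym α₀-weight) 1<m))
    ... | inj₂ 1≡m with reps-ok r₀∈
    ...   | l , w , _ , nk with necklace-ends-true r₀ nk (subst (0 <_) (sym w) z<s)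
    ...     | b , refl = S⁺ α₀-length (chosen r₀∈ 0 (cong (_++ [ true ]) (trans (cong zeros (sym lb)) (sym (weight-zero b wb)))))
      where
      lb : length b ≡ n-1
      lb = suc-injective (trans (sym (length-∷ʳ b true)) l)
      wb : weight b ≡ 0
      wb = suc-injective (trans (sym (weight-∷ʳ-true b)) (trans w (sym 1≡m)))

    bounds : ∀ {i} → i ∈ indices n s → 0 < i × i + i ≤ suc n × i ≤ s
    bounds = indices-bounds n s s<n

  open GammaS n-1 m-1 h reps reps-weight s₀ n≤2m alt

  private
    indices-S : ∀ {i} → i ∈ indices n s → S (gamma n i)
    indices-S {i} i∈ with bounds i∈
    ... | 0<i , 2i≤ , i≤s = gamma-S i 0<i 2i≤ (≤-<-trans i≤s s<h)

  open Shortened n-1 m h reps reps-weight s₀ s (indices n s)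
    (λ i∈ → proj₁ (bounds i∈) , proj₁ (proj₂ (bounds i∈))) indices-S (inR⁻ n s) (inR⁺ n s)

  private
    skipped : List Str
    skipped = concatMap (λ i → applyUpTo (seg n i) i) (indices n s)

    ∈-skipped⁻ : ∀ {y} → y ∈ skipped → ∃₂ λ i k → i ∈ indices n s × k < i × y ≡ seg n i k
    ∈-skipped⁻ y∈ with concatMap⁻ (λ i → applyUpTo (seg n i) i) (indices n s) y∈
    ... | i , i∈ , y∈′ with ∈-applyUpTo⁻ (seg n i) y∈′
    ...   | k , k< , e = i , k , i∈ , k< , e

    ∈-skipped⁺ : ∀ {i k} → i ∈ indices n s → k < i → seg n i k ∈ skipped
    ∈-skipped⁺ {i} i∈ k< = concatMap⁺ (λ i → applyUpTo (seg n i) i) i∈ (∈-applyUpTo⁺ (seg n i) k<)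

    skipped-unique : Unique skipped
    skipped-unique = concatMap-unique _ (indices-unique n s s<n)
      (λ {i} i∈ → Uniq.applyUpTo⁺₁ (seg n i) i λ j<k k<i e →
        <-irrefl (proj₂ (seg-injective i∈ i∈ (<-trans j<k k<i) k<i e)) j<k)
      disjoint
      where
      disjoint : ∀ {i i′ y} → i ∈ indices n s → i′ ∈ indices n s →
                 y ∈ applyUpTo (seg n i) i → y ∈ applyUpTo (seg n i′) i′ → i ≡ i′
      disjoint {i} {i′} i∈ i′∈ y∈ y∈′ with ∈-applyUpTo⁻ (seg n i) y∈ | ∈-applyUpTo⁻ (seg n i′) y∈′
      ... | k , k< , refl | k′ , k′< , e = proj₁ (seg-injective i∈ i′∈ k< k′< e)

    length-skipped : length skipped ≡ s
    length-skipped = trans (length-concatMap (λ i → applyUpTo (seg n i) i) id {indices n s}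
      (λ {i} _ → length-applyUpTo (seg n i) i)) (indices-sum n s)

    kept? : ∀ x → Dec (x ∉ skipped)
    kept? x = ¬? (any? (x ≟ₛ_) skipped)

    kept : List Str
    kept = filter kept? strings

    kept-unique : Unique kept
    kept-unique = Uniq.filter⁺ kept? strings-unique

    ∈-kept⁺ : ∀ {y} → Good y → y ∈ kept
    ∈-kept⁺ {y} (sy , out) = ∈-filter⁺ kept? (∈-strings⁺ sy) λ y∈ → avoid (∈-skipped⁻ y∈)
      where
      avoid : ¬ (∃₂ λ i k → i ∈ indices n s × k < i × y ≡ seg n i k)
      avoid (i , k , i∈ , k< , e) = out i∈ k< e

    ∈-kept⁻ : ∀ {y} → y ∈ kept → Good y
    ∈-kept⁻ y∈ with ∈-filter⁻ kept? {xs = strings} y∈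
    ... | y∈S , y∉ = ∈-strings⁻ y∈S , λ i∈ k< e → y∉ (subst (_∈ skipped) (sym e) (∈-skipped⁺ i∈ k<))

    length-kept : length kept ≡ L
    length-kept = +-cancelʳ-≡ s (length kept) L (begin
      length kept + s              ≡⟨ cong (length kept +_) (sym length-skipped) ⟩
      length kept + length skipped ≡⟨ sym (length-++ kept) ⟩
      length (kept ++ skipped)     ≡⟨ unique-⇔-length (Uniq.++⁺ kept-unique skipped-unique disjoint) strings-unique to from ⟩
      length strings               ≡⟨ length-strings ⟩
      total                        ≡⟨ sym (m+[n∸m]≡n L≤total) ⟩
      L + s                        ∎)
      where
      open ≡-Reasoning
      disjoint : ∀ {y} → ¬ (y ∈ kept × y ∈ skipped)
      disjoint (y∈ , y∈′) = proj₂ (∈-filter⁻ kept? {xs = strings} y∈) y∈′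
      to : ∀ {y} → y ∈ kept ++ skipped → y ∈ strings
      to y∈ with ∈-++⁻ kept y∈
      ... | inj₁ y∈₁ = proj₁ (∈-filter⁻ kept? {xs = strings} y∈₁)
      ... | inj₂ y∈₂ with ∈-skipped⁻ y∈₂
      ...   | i , k , i∈ , k< , refl = ∈-strings⁺ (seg-S i∈ k k<)
      from : ∀ {y} → y ∈ strings → y ∈ kept ++ skipped
      from {y} y∈ with any? (y ≟ₛ_) skipped
      ... | yes y∈′ = ∈-++⁺ʳ kept y∈′
      ... | no  y∉  = ∈-++⁺ˡ (∈-filter⁺ kept? y∈ y∉)

    open Orbit _≟ₛ_ f α₀ (good-reachable α₀-good) kept-unique
      (λ y∈ → Product.map suc id (good-reachable (∈-kept⁻ y∈)))
      (λ k → ∈-kept⁺ (good-iter k α₀-good))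

  returns-after-L : iter f L α₀ ≡ α₀
  returns-after-L = subst (λ l → iter f l α₀ ≡ α₀) length-kept returns

  windows-distinct : ∀ i j → i < L → j < L →
    let c = map (λ k → firstSym (iter f k α₀)) (upTo L)
    in cycWindow c n i ≡ cycWindow c n j → i ≡ j
  windows-distinct i j i<L j<L e = injective i j
    (subst (i <_) (sym length-kept) i<L) (subst (j <_) (sym length-kept) j<L)
    (trans (sym (window i i<L)) (trans e (window j j<L)))
    where
    open ShiftRegister f (λ a u → _ , refl)
    window : ∀ i → i < L → cycWindow (map (λ k → firstSym (iter f k α₀)) (upTo L)) n i ≡ iter f i α₀
    window = cycWindow-state (λ k → S.size (proj₁ (good-iter k α₀-good))) returns-after-L

-- Consequences of the choice of m, h and t

A-large : ∀ n-1 m L → 2 ^ n-1 < L → L ≤ A (suc n-1) m → suc n-1 ≤ m + m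
A-large n-1 m L 2^<L L≤A = ≮⇒≥ λ m+m<n → <⇒≱ (+-mono-< 2^<L 2^<L) (begin
  L + L                         ≤⟨ +-mono-≤ L≤A L≤A ⟩
  A (suc n-1) m + A (suc n-1) m ≤⟨ A-half (suc n-1) m m+m<n ⟩
  2 ^ suc n-1                   ≡⟨ cong (2 ^ n-1 +_) (+-identityʳ (2 ^ n-1)) ⟩
  2 ^ n-1 + 2 ^ n-1             ∎)
  where open ≤-Reasoning

C-zero : ∀ n-1 w → C (suc n-1) w 0 ≡ 0
C-zero n-1 w = trans (countB≡length p (allStrings (suc n-1)))
  (cong length (filter-none (λ a → p a BoolP.≟ true) (All.tabulate none)))
  where
  p : Str → Bool
  p a = (weight a ≡ᵇ w) ∧ (period a ≤ᵇ 0)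
  none : ∀ {a} → a ∈ allStrings (suc n-1) → ¬ p a ≡ true
  none {a} a∈ e = <⇒≱ (Repeats.positive (period-repeats a (subst (0 <_) (sym (∈-allStrings⁻ (suc n-1) a∈)) z<s)))
                      (≤ᵇ-true⁻ {period a} (proj₂ (∧-true⁻ {weight a ≡ᵇ w} e)))

theorem1 : (n L m h t : ℕ) → 1 ≤ n → 2 ^ (n ∸ 1) < L → L ≤ 2 ^ n →
    L ≤ A n m → (∀ w → w < m → A n w < L) →
    L ≤ A n (m ∸ 1) + C n m h → (∀ p → p < h → A n (m ∸ 1) + C n m p < L) →
    L ≤ A n (m ∸ 1) + C n m (h ∸ 1) + t * h →
    (∀ t′ → t′ < t → A n (m ∸ 1) + C n m (h ∸ 1) + t′ * h < L) →
    (reps : List Str) → length reps ≡ t →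
    All (λ r → (length r ≡ n) × ((weight r ≡ m) × ((period r ≡ h) × (necklace r ≡ true)))) reps →
    Unique reps →
    (n ≡ 2 * m ∸ 1 → inT reps (altStr m) ≡ true) →
    let s = A n (m ∸ 1) + C n m (h ∸ 1) + h * t ∸ L
        α0 = replicate (n ∸ 1) false ++ [ true ]
        f = step n m h s reps
        c = map (λ i → firstSym (iter f i α0)) (upTo L)
    in (iter f L α0 ≡ α0) × ((length c ≡ L) ×
       (∀ i j → i < L → j < L → cycWindow c n i ≡ cycWindow c n j → i ≡ j))
theorem1 (suc n) L zero h t _ 2^<L _ L≤A _ _ _ _ _ _ _ _ _ _ =
  ⊥-elim (<⇒≱ z<s (A-large n 0 L 2^<L L≤A))
-- No string has period 0, so `h = 0` would make a smaller weight bound suffice.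
theorem1 (suc n) L (suc m) zero t _ _ _ _ minA L≤C _ _ _ _ _ _ _ _ =
  ⊥-elim (<⇒≱ (minA m ≤-refl)
    (subst (L ≤_) (trans (cong (A (suc n) m +_) (C-zero n (suc m))) (+-identityʳ _)) L≤C))
-- Without any chosen cycle the preceding period bound would already suffice.
theorem1 (suc n) L (suc m) (suc h) zero _ _ _ _ _ _ minC L≤T _ _ _ _ _ _ =
  ⊥-elim (<⇒≱ (minC h ≤-refl) (subst (L ≤_) (+-identityʳ _) L≤T))
theorem1 (suc n) L (suc m) (suc h) (suc t) _ 2^<L _ L≤A _ _ _ L≤T minT reps@(_ ∷ _) refl ok uniq alt =
  returns-after-L , trans (length-map _ (upTo L)) (length-upTo L) , windows-distinct
  where
  base = A (suc n) m + C (suc n) (suc m) h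
  swap : base + suc t * suc h ≡ base + suc h * suc t
  swap = cong (base +_) (*-comm (suc t) (suc h))
  below : base + suc h * suc t < L + suc h
  -- By the minimality of the number of cycles, one cycle fewer leaves less than `L` strings. This
  -- gives s < h.
  below = subst (_< L + suc h)
    (trans (+-assoc base (t * suc h) (suc h)) (trans (cong (base +_) (+-comm (t * suc h) (suc h))) swap))
    (+-monoˡ-< (suc h) (minT t ≤-refl))
  open CutDown n m h L reps (All.lookup ok) uniq alt (A-large n (suc m) L 2^<L L≤A) (here refl)
    (subst (L ≤_) swap L≤T) below
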